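{- Let $W$ be an instance of $\text{WSP}_1(=,\neq)$ (where the workflow specification may be conditional, i.e. non-deterministic). Then we can determine whether $W$ is weakly satisfiable, or whether $W$ is strongly satisfiable, in time $O\big(\sharp(W)(\flat(W)-1)^{\flat(W)}\big)$.
   Context: Workflows and composition. A workflow specification is a directed acyclic graph $(S,E)$ on a set $S$ of steps. Conditional workflow specifications are built from single steps by three binary operations applied to workflow specifications $W_1=(S_1,E_1)$, $W_2=(S_2,E_2)$ with disjoint step sets: serial composition $W_1;W_2$ (all steps of $W_1$ are completed before those of $W_2$), parallel composition $W_1\parallel W_2$ (the steps of $W_1$ and $W_2$ are all executed and may be interleaved), and xor composition $W_1\oplus W_2$ (either the steps of $W_1$ or those of $W_2$ are executed, but not both). Start, finish and joining nodes used to connect the graphs are orchestration nodes: no processing is performed and no constraints apply to them. Execution sets are defined recursively: a single step $s$ has the single execution set $\{s\}$; if $S_1,S_2$ are execution sets of $W_1,W_2$ respectively, then $S_1\cup S_2$ is an execution set of $W_1;W_2$ and of $W_1\parallel W_2$, and both $S_1$ and $S_2$ are execution sets of $W_1\oplus W_2$. $\sharp(W)$ denotes the number of possible execution sets of $W$, and $\flat(W)$ the maximum number of steps in any execution set of $W$. A workflow is deterministic if it has a single execution set, and non-deterministic otherwise. Constraints. Let $U$ be a set of users and $A\subseteq S\times U$ an authorization policy, where every step has at least one authorized user. A workflow constraint is $(\rho,T_1,T_2)$ with $T_1,T_2\subseteq S$, $\rho\subseteq U\times U$. A plan $\pi:S\to U$ is authorized if $(s,\pi(s))\in A$ for all $s\in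 S$; it satisfies $(\rho,T_1,T_2)$ if $(\pi(t_1),\pi(t_2))\in\rho$ for some $t_1\in T_1,t_2\in T_2$; it is valid if it is authorized and satisfies all constraints. A workflow with constraint set is satisfiable if a valid plan exists. In an instance of $\text{WSP}_1(=,\neq)$ every constraint has the form $(\rho,\{s\},\{s'\})$ with $\rho$ either $=$ (the diagonal $\{(u,u):u\in U\}$) or $\neq$ (its complement in $U\times U$). When forming $W_1;W_2$ or $W_1\parallel W_2$, all constraints of $W_1$ and $W_2$ are kept, and new constraints $(\rho,S',S'')$ may be added only if $S'\cup S''\not\subseteq S_1$ and $S'\cup S''\not\subseteq S_2$; no constraints are added when forming $W_1\oplus W_2$. Derived workflows. If $W=((S,E),U,A,C)$ has execution sets $S_1,\dots,S_m$, the derived deterministic workflows are $W_i=((S_i,E_i),U,A_i,C_i)$, where $E_i=(S_i\times S_i)\cap E$, $A_i=(S_i\times U)\cap A$, and $C_i$ consists of the constraints $(\rho,T_1\cap S_i,T_2\cap S_i)$ for those $(\rho,T_1,T_2)\in C$ with $T_1\cap S_i\neq\emptyset$ and $T_2\cap S_i\neq\emptyset$. $W$ is weakly satisfiable if some derived deterministic workflow is satisfiable, and strongly satisfiable if all derived deterministic workflows are satisfiable.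
   Formalization: The bound is proved up to a factor polynomial in the input size, and (♭(W)−1)^♭(W) is read as 1 when ♭(W)=1; literally it fails, e.g. two steps with one = constraint give O(1) though unboundedly many users must be read. -}

module Defs where

open import Data.Bool.Base using (Bool; true; false)
import Data.Bool.Properties as Bool
open import Data.Fin.Base using (Fin; toℕ)
open import Data.Fin.Subset
  using (Subset; _∈_; _⊆_; _∩_; _∪_; ⁅_⁆; ⊤; Nonempty; Empty; ∣_∣)
open import Data.Fin.Subset.Properties
  using (nonempty?; p∩q⊆q; x∈p∩q⁺; p⊆p∪q; q⊆p∪q; ⊆⊤; ∈⊤)
open import Data.List.Base
  using (List; []; _∷_; _++_; map; filter; foldr; length; deduplicate; cartesianProductWith)
open import Data.List.Membership.Propositional using () renaming (_∈_ to _∈ₗ_)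
open import Data.List.Relation.Unary.All using (All)
open import Data.Nat.Base using (ℕ; zero; suc; _+_; _*_; _∸_; _^_; _⊔_; _≤_)
open import Data.Product.Base using (Σ-syntax; ∃-syntax; ∃₂; _×_; _,_; proj₁; proj₂)
open import Data.Sum.Base using (_⊎_; inj₁; inj₂)
open import Data.Vec.Base as Vec using (Vec; []; _∷_; lookup)
import Data.Vec.Properties as Vec
open import Data.Empty using (⊥-elim)
open import Level using (Level; 0ℓ)
open import Relation.Binary.Core using (Rel; REL)
open import Relation.Binary.Definitions using (Transitive; DecidableEquality)
open import Relation.Binary.Construct.Closure.Transitive
  using (TransClosure; [_]; _∷_; transitive⁻)
open import Relation.Binary.PropositionalEquality
  using (_≡_; _≢_; refl)
open import Relation.Nullary using (¬_; Reflects; _×-dec_)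

private
  variable
    m n : ℕ

------------------------------------------------------------------------
-- Conditional workflow specifications

infixr 5 _⨾_⟨_⟩ _∥_⟨_⟩ _⊕_⟨_⟩

mutual

  data Spec (m : ℕ) : Set where
    step    : Fin m → Spec m
    _⨾_⟨_⟩  : (W₁ W₂ : Spec m) → Empty (steps W₁ ∩ steps W₂) → Spec m
    _∥_⟨_⟩  : (W₁ W₂ : Spec m) → Empty (steps W₁ ∩ steps W₂) → Spec m
    _⊕_⟨_⟩  : (W₁ W₂ : Spec m) → Empty (steps W₁ ∩ steps W₂) → Spec m

  steps : Spec m → Subset m
  steps (step s)       = ⁅ s ⁆
  steps (W₁ ⨾ W₂ ⟨ _ ⟩) = steps W₁ ∪ steps W₂
  steps (W₁ ∥ W₂ ⟨ _ ⟩) = steps W₁ ∪ steps W₂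
  steps (W₁ ⊕ W₂ ⟨ _ ⟩) = steps W₁ ∪ steps W₂

-- The edges between steps that remain once the orchestration nodes are
-- contracted: `Edge W s t` says that s must be completed before t.
data Edge {m} : Spec m → Rel (Fin m) 0ℓ where
  ⨾-left   : ∀ {W₁ W₂ d s t} → Edge W₁ s t → Edge (W₁ ⨾ W₂ ⟨ d ⟩) s t
  ⨾-right  : ∀ {W₁ W₂ d s t} → Edge W₂ s t → Edge (W₁ ⨾ W₂ ⟨ d ⟩) s t
  ⨾-across : ∀ {W₁ W₂ d s t} → s ∈ steps W₁ → t ∈ steps W₂ → Edge (W₁ ⨾ W₂ ⟨ d ⟩) s t
  ∥-left   : ∀ {W₁ W₂ d s t} → Edge W₁ s t → Edge (W₁ ∥ W₂ ⟨ d ⟩) s t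
  ∥-right  : ∀ {W₁ W₂ d s t} → Edge W₂ s t → Edge (W₁ ∥ W₂ ⟨ d ⟩) s t
  ⊕-left   : ∀ {W₁ W₂ d s t} → Edge W₁ s t → Edge (W₁ ⊕ W₂ ⟨ d ⟩) s t
  ⊕-right  : ∀ {W₁ W₂ d s t} → Edge W₂ s t → Edge (W₁ ⊕ W₂ ⟨ d ⟩) s t

edge-steps : ∀ (W : Spec m) {s t} → Edge W s t → s ∈ steps W × t ∈ steps W
edge-steps (W₁ ⨾ W₂ ⟨ d ⟩) (⨾-left e) =
  let p , q = edge-steps W₁ e in p⊆p∪q _ p , p⊆p∪q _ q
edge-steps (W₁ ⨾ W₂ ⟨ d ⟩) (⨾-right e) =
  let p , q = edge-steps W₂ e in q⊆p∪q (steps W₁) _ p , q⊆p∪q (steps W₁) _ q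
edge-steps (W₁ ⨾ W₂ ⟨ d ⟩) (⨾-across p q) = p⊆p∪q _ p , q⊆p∪q (steps W₁) _ q
edge-steps (W₁ ∥ W₂ ⟨ d ⟩) (∥-left e) =
  let p , q = edge-steps W₁ e in p⊆p∪q _ p , p⊆p∪q _ q
edge-steps (W₁ ∥ W₂ ⟨ d ⟩) (∥-right e) =
  let p , q = edge-steps W₂ e in q⊆p∪q (steps W₁) _ p , q⊆p∪q (steps W₁) _ q
edge-steps (W₁ ⊕ W₂ ⟨ d ⟩) (⊕-left e) =
  let p , q = edge-steps W₁ e in p⊆p∪q _ p , p⊆p∪q _ q
edge-steps (W₁ ⊕ W₂ ⟨ d ⟩) (⊕-right e) =
  let p , q = edge-steps W₂ e in q⊆p∪q (steps W₁) _ p , q⊆p∪q (steps W₁) _ q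

edge-irrefl : ∀ (W : Spec m) {s} → ¬ Edge W s s
edge-irrefl (W₁ ⨾ W₂ ⟨ d ⟩) (⨾-left e)     = edge-irrefl W₁ e
edge-irrefl (W₁ ⨾ W₂ ⟨ d ⟩) (⨾-right e)    = edge-irrefl W₂ e
edge-irrefl (W₁ ⨾ W₂ ⟨ d ⟩) (⨾-across p q) = d (_ , x∈p∩q⁺ (p , q))
edge-irrefl (W₁ ∥ W₂ ⟨ d ⟩) (∥-left e)     = edge-irrefl W₁ e
edge-irrefl (W₁ ∥ W₂ ⟨ d ⟩) (∥-right e)    = edge-irrefl W₂ e
edge-irrefl (W₁ ⊕ W₂ ⟨ d ⟩) (⊕-left e)     = edge-irrefl W₁ e
edge-irrefl (W₁ ⊕ W₂ ⟨ d ⟩) (⊕-right e)    = edge-irrefl W₂ e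

edge-trans : ∀ (W : Spec m) → Transitive (Edge W)
edge-trans (W₁ ⨾ W₂ ⟨ d ⟩) (⨾-left e) (⨾-left f) = ⨾-left (edge-trans W₁ e f)
edge-trans (W₁ ⨾ W₂ ⟨ d ⟩) (⨾-left e) (⨾-right f) =
  ⨾-across (proj₁ (edge-steps W₁ e)) (proj₂ (edge-steps W₂ f))
edge-trans (W₁ ⨾ W₂ ⟨ d ⟩) (⨾-left e) (⨾-across p q) =
  ⨾-across (proj₁ (edge-steps W₁ e)) q
edge-trans (W₁ ⨾ W₂ ⟨ d ⟩) (⨾-right e) (⨾-left f) =
  ⊥-elim (d (_ , x∈p∩q⁺ (proj₁ (edge-steps W₁ f) , proj₂ (edge-steps W₂ e))))
edge-trans (W₁ ⨾ W₂ ⟨ d ⟩) (⨾-right e) (⨾-right f) = ⨾-right (edge-trans W₂ e f)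
edge-trans (W₁ ⨾ W₂ ⟨ d ⟩) (⨾-right e) (⨾-across p q) =
  ⊥-elim (d (_ , x∈p∩q⁺ (p , proj₂ (edge-steps W₂ e))))
edge-trans (W₁ ⨾ W₂ ⟨ d ⟩) (⨾-across p q) (⨾-left f) =
  ⊥-elim (d (_ , x∈p∩q⁺ (proj₁ (edge-steps W₁ f) , q)))
edge-trans (W₁ ⨾ W₂ ⟨ d ⟩) (⨾-across p q) (⨾-right f) =
  ⨾-across p (proj₂ (edge-steps W₂ f))
edge-trans (W₁ ⨾ W₂ ⟨ d ⟩) (⨾-across p q) (⨾-across p′ q′) = ⨾-across p q′
edge-trans (W₁ ∥ W₂ ⟨ d ⟩) (∥-left e) (∥-left f) = ∥-left (edge-trans W₁ e f)
edge-trans (W₁ ∥ W₂ ⟨ d ⟩) (∥-left e) (∥-right f) =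
  ⊥-elim (d (_ , x∈p∩q⁺ (proj₂ (edge-steps W₁ e) , proj₁ (edge-steps W₂ f))))
edge-trans (W₁ ∥ W₂ ⟨ d ⟩) (∥-right e) (∥-left f) =
  ⊥-elim (d (_ , x∈p∩q⁺ (proj₁ (edge-steps W₁ f) , proj₂ (edge-steps W₂ e))))
edge-trans (W₁ ∥ W₂ ⟨ d ⟩) (∥-right e) (∥-right f) = ∥-right (edge-trans W₂ e f)
edge-trans (W₁ ⊕ W₂ ⟨ d ⟩) (⊕-left e) (⊕-left f) = ⊕-left (edge-trans W₁ e f)
edge-trans (W₁ ⊕ W₂ ⟨ d ⟩) (⊕-left e) (⊕-right f) =
  ⊥-elim (d (_ , x∈p∩q⁺ (proj₂ (edge-steps W₁ e) , proj₁ (edge-steps W₂ f))))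
edge-trans (W₁ ⊕ W₂ ⟨ d ⟩) (⊕-right e) (⊕-left f) =
  ⊥-elim (d (_ , x∈p∩q⁺ (proj₁ (edge-steps W₁ f) , proj₂ (edge-steps W₂ e))))
edge-trans (W₁ ⊕ W₂ ⟨ d ⟩) (⊕-right e) (⊕-right f) = ⊕-right (edge-trans W₂ e f)

edge-acyclic : ∀ (W : Spec m) {s} → ¬ TransClosure (Edge W) s s
edge-acyclic W c = edge-irrefl W (transitive⁻ (Edge W) (edge-trans W) c)

executionSets : Spec m → List (Subset m)
executionSets (step s)        = ⁅ s ⁆ ∷ []
executionSets (W₁ ⨾ W₂ ⟨ _ ⟩) = cartesianProductWith _∪_ (executionSets W₁) (executionSets W₂)
executionSets (W₁ ∥ W₂ ⟨ _ ⟩) = cartesianProductWith _∪_ (executionSets W₁) (executionSets W₂)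
executionSets (W₁ ⊕ W₂ ⟨ _ ⟩) = executionSets W₁ ++ executionSets W₂

_≟ₛ_ : DecidableEquality (Subset m)
_≟ₛ_ = Vec.≡-dec Bool._≟_

♯ : Spec m → ℕ
♯ W = length (deduplicate _≟ₛ_ (executionSets W))

♭ : Spec m → ℕ
♭ W = foldr _⊔_ 0 (map ∣_∣ (executionSets W))

-- May a constraint (ρ , T₁ , T₂) with T₁ ∪ T₂ = T occur in a constrained
-- workflow whose specification is the given one?
Admissible : Subset m → Spec m → Set
Admissible T (step s)        = T ⊆ ⁅ s ⁆
Admissible T (W₁ ⨾ W₂ ⟨ _ ⟩) =
  Admissible T W₁ ⊎ Admissible T W₂ ⊎
  (T ⊆ steps W₁ ∪ steps W₂ × ¬ T ⊆ steps W₁ × ¬ T ⊆ steps W₂)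
Admissible T (W₁ ∥ W₂ ⟨ _ ⟩) =
  Admissible T W₁ ⊎ Admissible T W₂ ⊎
  (T ⊆ steps W₁ ∪ steps W₂ × ¬ T ⊆ steps W₁ × ¬ T ⊆ steps W₂)
Admissible T (W₁ ⊕ W₂ ⟨ _ ⟩) = Admissible T W₁ ⊎ Admissible T W₂

------------------------------------------------------------------------
-- Workflows ((S , E) , U , A , C) with S ⊆ Fin m and U = Fin n

record Constraint (n : ℕ) (S : Subset m) : Set₁ where
  field
    ρ     : Rel (Fin n) 0ℓ
    T₁ T₂ : Subset m
    T₁⊆S  : T₁ ⊆ S
    T₂⊆S  : T₂ ⊆ S

record Workflow (m n : ℕ) : Set₁ where
  field
    S          : Subset m
    E          : Rel (Fin m) 0ℓ
    E⊆S×S      : ∀ {s t} → E s t → s ∈ S × t ∈ S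
    acyclic    : ∀ {s} → ¬ TransClosure E s s
    A          : REL (Fin m) (Fin n) 0ℓ
    A⊆S×U      : ∀ {s u} → A s u → s ∈ S
    authorized : ∀ {s} → s ∈ S → ∃[ u ] A s u
    C          : List (Constraint n S)

Plan : Subset m → ℕ → Set
Plan S n = ∀ s → s ∈ S → Fin n

module _ {S : Subset m} where

  Satisfies : Plan S n → Constraint n S → Set
  Satisfies π c = ∃₂ λ t₁ t₂ →
    Σ[ p ∈ t₁ ∈ T₁ ] Σ[ q ∈ t₂ ∈ T₂ ] ρ (π t₁ (T₁⊆S p)) (π t₂ (T₂⊆S q))
    where open Constraint c

module _ (W : Workflow m n) where
  open Workflow W

  Authorized : Plan S n → Set
  Authorized π = ∀ s (p : s ∈ S) → A s (π s p)

  Valid : Plan S n → Set₁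
  Valid π = Authorized π × All (Satisfies π) C

  Satisfiable : Set₁
  Satisfiable = ∃[ π ] Valid π

restrict : {S : Subset m} (T : Subset m) → Constraint n S → Constraint n T
restrict T c = record
  { ρ    = ρ
  ; T₁   = T₁ ∩ T
  ; T₂   = T₂ ∩ T
  ; T₁⊆S = p∩q⊆q T₁ T
  ; T₂⊆S = p∩q⊆q T₂ T
  }
  where open Constraint c

restrictAll : {S : Subset m} (T : Subset m) → List (Constraint n S) → List (Constraint n T)
restrictAll T C =
  map (restrict T) (filter (λ c → nonempty? (T₁ c ∩ T) ×-dec nonempty? (T₂ c ∩ T)) C)
  where open Constraint

derived : (W : Workflow m n) (T : Subset m) → T ⊆ Workflow.S W → Workflow m n
derived {m} W T T⊆S = record
  { S          = T
  ; E          = E′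
  ; E⊆S×S      = λ (s∈T , t∈T , _) → s∈T , t∈T
  ; acyclic    = λ c → acyclic (forget c)
  ; A          = λ s u → s ∈ T × A s u
  ; A⊆S×U      = proj₁
  ; authorized = λ s∈T → let u , a = authorized (T⊆S s∈T) in u , s∈T , a
  ; C          = restrictAll T C
  }
  where
  open Workflow W

  E′ : Rel (Fin m) 0ℓ
  E′ s t = s ∈ T × t ∈ T × E s t

  forget : ∀ {s t} → TransClosure E′ s t → TransClosure E s t
  forget [ (_ , _ , e) ]     = [ e ]
  forget ((_ , _ , e) ∷ c) = e ∷ forget c

------------------------------------------------------------------------
-- WSP₁(=,≠)

data Op : Set where
  eq neq : Op

⟦_⟧ : Op → Rel (Fin n) 0ℓ
⟦ eq ⟧  = _≡_
⟦ neq ⟧ = _≢_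

-- The triple (o , s , s′) presents the constraint (⟦ o ⟧ , {s} , {s′}), and
-- entry s of `policy` is the set of users authorized for s.
record Instance : Set where
  field
    {#S #U}     : ℕ
    spec        : Spec #S
    covers      : steps spec ≡ ⊤
    policy      : Vec (Subset #U) #S
    nonempty    : ∀ s → Nonempty (lookup policy s)
    constraints : List (Op × Fin #S × Fin #S)
    admissible  : All (λ (_ , s , s′) → Admissible (⁅ s ⁆ ∪ ⁅ s′ ⁆) spec) constraints

  constraint : Op × Fin #S × Fin #S → Constraint #U ⊤
  constraint (o , s , s′) = record
    { ρ = ⟦ o ⟧ ; T₁ = ⁅ s ⁆ ; T₂ = ⁅ s′ ⁆ ; T₁⊆S = ⊆⊤ ; T₂⊆S = ⊆⊤ }

  workflow : Workflow #S #U
  workflow = record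
    { S          = ⊤
    ; E          = Edge spec
    ; E⊆S×S      = λ _ → ∈⊤ , ∈⊤
    ; acyclic    = edge-acyclic spec
    ; A          = λ s u → u ∈ lookup policy s
    ; A⊆S×U      = λ _ → ∈⊤
    ; authorized = λ {s} _ → nonempty s
    ; C          = map constraint constraints
    }

WeaklySatisfiable : Instance → Set₁
WeaklySatisfiable I =
  ∃[ T ] (T ∈ₗ executionSets spec × Satisfiable (derived workflow T ⊆⊤))
  where open Instance I

StronglySatisfiable : Instance → Set₁
StronglySatisfiable I =
  ∀ T → T ∈ₗ executionSets spec → Satisfiable (derived workflow T ⊆⊤)
  where open Instance I

------------------------------------------------------------------------
-- Model of computation: a first-order functional language over binary
-- trees with general recursion, in which every operation has unit cost.
-- Time is polynomially related to that of Turing machines: an operation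
-- only copies, allocates or inspects one pointer.

infixr 6 _∙_

data Tree : Set where
  nil : Tree
  _∙_ : Tree → Tree → Tree

size : Tree → ℕ
size nil     = 1
size (x ∙ y) = suc (size x + size y)

-- Expressions with k function symbols and v variables (de Bruijn indices).
-- `case` binds the left subtree as variable 0 and the right one as variable 1.
data Expr (k v : ℕ) : Set where
  var   : Fin v → Expr k v
  nil   : Expr k v
  _∙_   : Expr k v → Expr k v → Expr k v
  case  : Expr k v → Expr k v → Expr k (2 + v) → Expr k v
  let′  : Expr k v → Expr k (1 + v) → Expr k v
  call  : Fin k → Expr k v → Expr k v

record Program : Set where
  field
    arity  : ℕ
    bodies : Vec (Expr arity 1) arity
    main   : Expr arity 1

-- bodies , γ ⊢ e ⇓ x [ t ]: in environment γ, the expression e evaluates to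
-- x in time t.
infix 4 _,_⊢_⇓_[_]

data _,_⊢_⇓_[_] {k} (bs : Vec (Expr k 1) k) {v} (γ : Vec Tree v) :
                Expr k v → Tree → ℕ → Set where
  var    : ∀ {i} → bs , γ ⊢ var i ⇓ lookup γ i [ 1 ]
  nil    : bs , γ ⊢ nil ⇓ nil [ 1 ]
  _∙_    : ∀ {e₁ e₂ x y t₁ t₂} →
           bs , γ ⊢ e₁ ⇓ x [ t₁ ] → bs , γ ⊢ e₂ ⇓ y [ t₂ ] →
           bs , γ ⊢ e₁ ∙ e₂ ⇓ x ∙ y [ suc (t₁ + t₂) ]
  case-nil : ∀ {e e₁ e₂ z t₁ t₂} →
           bs , γ ⊢ e ⇓ nil [ t₁ ] → bs , γ ⊢ e₁ ⇓ z [ t₂ ] →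
           bs , γ ⊢ case e e₁ e₂ ⇓ z [ suc (t₁ + t₂) ]
  case-∙ : ∀ {e e₁ e₂ x y z t₁ t₂} →
           bs , γ ⊢ e ⇓ x ∙ y [ t₁ ] → bs , x ∷ y ∷ γ ⊢ e₂ ⇓ z [ t₂ ] →
           bs , γ ⊢ case e e₁ e₂ ⇓ z [ suc (t₁ + t₂) ]
  let′   : ∀ {e₁ e₂ x y t₁ t₂} →
           bs , γ ⊢ e₁ ⇓ x [ t₁ ] → bs , x ∷ γ ⊢ e₂ ⇓ y [ t₂ ] →
           bs , γ ⊢ let′ e₁ e₂ ⇓ y [ suc (t₁ + t₂) ]
  call   : ∀ {f e x y t₁ t₂} →
           bs , γ ⊢ e ⇓ x [ t₁ ] → bs , x ∷ [] ⊢ lookup bs f ⇓ y [ t₂ ] →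
           bs , γ ⊢ call f e ⇓ y [ suc (t₁ + t₂) ]

⇓-deterministic : ∀ {k} {bs : Vec (Expr k 1) k} {v} {γ : Vec Tree v} {e x y t u} →
                  bs , γ ⊢ e ⇓ x [ t ] → bs , γ ⊢ e ⇓ y [ u ] → x ≡ y × t ≡ u
⇓-deterministic var var = refl , refl
⇓-deterministic nil nil = refl , refl
⇓-deterministic (p ∙ q) (p′ ∙ q′)
  with refl , refl ← ⇓-deterministic p p′ | refl , refl ← ⇓-deterministic q q′ = refl , refl
⇓-deterministic (case-nil p q) (case-nil p′ q′)
  with refl , refl ← ⇓-deterministic p p′ | refl , refl ← ⇓-deterministic q q′ = refl , refl
⇓-deterministic (case-nil p q) (case-∙ p′ q′) with () , _ ← ⇓-deterministic p p′
⇓-deterministic (case-∙ p q) (case-nil p′ q′) with () , _ ← ⇓-deterministic p p′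
⇓-deterministic (case-∙ p q) (case-∙ p′ q′)
  with refl , refl ← ⇓-deterministic p p′
  with refl , refl ← ⇓-deterministic q q′ = refl , refl
⇓-deterministic (let′ p q) (let′ p′ q′)
  with refl , refl ← ⇓-deterministic p p′
  with refl , refl ← ⇓-deterministic q q′ = refl , refl
⇓-deterministic (call p q) (call p′ q′)
  with refl , refl ← ⇓-deterministic p p′
  with refl , refl ← ⇓-deterministic q q′ = refl , refl

Runs : Program → Tree → Tree → ℕ → Set
Runs P x y t = bodies , x ∷ [] ⊢ main ⇓ y [ t ]
  where open Program P

------------------------------------------------------------------------
-- Encoding of instances: numbers in unary, sets of users as bit vectors

encodeBool : Bool → Tree
encodeBool false = nil
encodeBool true  = nil ∙ nil

encodeℕ : ℕ → Tree
encodeℕ zero    = nil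
encodeℕ (suc i) = nil ∙ encodeℕ i

encodeFin : Fin m → Tree
encodeFin i = encodeℕ (toℕ i)

encodeList : ∀ {a : Level} {X : Set a} → (X → Tree) → List X → Tree
encodeList f []       = nil
encodeList f (x ∷ xs) = f x ∙ encodeList f xs

encodeSubset : Subset n → Tree
encodeSubset p = encodeList encodeBool (Vec.toList p)

encodeSpec : Spec m → Tree
encodeSpec (step s)        = encodeℕ 0 ∙ encodeFin s
encodeSpec (W₁ ⨾ W₂ ⟨ _ ⟩) = encodeℕ 1 ∙ encodeSpec W₁ ∙ encodeSpec W₂
encodeSpec (W₁ ∥ W₂ ⟨ _ ⟩) = encodeℕ 2 ∙ encodeSpec W₁ ∙ encodeSpec W₂
encodeSpec (W₁ ⊕ W₂ ⟨ _ ⟩) = encodeℕ 3 ∙ encodeSpec W₁ ∙ encodeSpec W₂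

encodeOp : Op → Tree
encodeOp eq  = encodeBool true
encodeOp neq = encodeBool false

encodeConstraint : Op × Fin m × Fin m → Tree
encodeConstraint (o , s , s′) = encodeOp o ∙ encodeFin s ∙ encodeFin s′

encode : Instance → Tree
encode I =
  encodeSpec spec ∙
  encodeList encodeSubset (Vec.toList policy) ∙
  encodeList encodeConstraint constraints
  where open Instance I

------------------------------------------------------------------------
-- Decision in bounded time

DecidesInTime : ∀ {ℓ} → Program → (Instance → Set ℓ) → (Instance → ℕ) → Set ℓ
DecidesInTime P L T = ∀ I →
  ∃₂ λ b t → Runs P (encode I) (encodeBool b) t × Reflects (L I) b × t ≤ T I

-- L is decidable in time O(f) up to a factor polynomial in the size of the
-- input.
DecidableInTimeO : ∀ {ℓ} → (Instance → Set ℓ) → (Instance → ℕ) → Set ℓ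
DecidableInTimeO L f =
  Σ[ P ∈ Program ] ∃₂ λ c d →
    DecidesInTime P L (λ I → c * size (encode I) ^ d * f I)

-- ♯(W) (♭(W) − 1)^♭(W).  When ♭(W) = 1 the second factor would be 0, which
-- cannot bound a running time, so it is replaced by 1; for ♭(W) ≥ 2 it is at
-- least 1 and `_⊔ 1` has no effect.
bound : Instance → ℕ
bound I = ♯ spec * ((♭ spec ∸ 1) ^ ♭ spec ⊔ 1)
  where open Instance I

{-# OPTIONS --safe #-}

-- Up to a constant, (k − 1)^k dominates c^k for every fixed c, so each
-- execution set L may be treated in time 4^|L| times a polynomial.  A valid
-- plan for L is the chain ∅ = X₀ ⊆ X₁ ⊆ … ⊆ Xₙ = L, where Xⱼ holds the steps
-- assigned to the first j users: user j executes Xⱼ₊₁ ∖ Xⱼ, and the constraints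
-- = and ≠ only concern the blocks of this partition one at a time.  Hence it
-- suffices to compute, user by user, the family of sublists of L that can occur
-- as Xⱼ; a stage compares at most 2^|L| candidates with at most 2^|L| members
-- of the previous family.  The execution sets of W are enumerated without
-- repetition because its components have disjoint step sets.

module Submission where

open import Defs
open import Data.Bool.Base using (Bool; true; false; T; not; _∧_; _∨_; if_then_else_)
open import Data.Empty using (⊥-elim)
open import Data.Fin using (#_; _≟_)
open import Data.Fin.Base using (Fin; zero; suc; toℕ)
import Data.Fin.Properties as Fin
open import Data.Fin.Subset
  using (Subset; ⊥; ⁅_⁆; _∪_; _∩_; _⊆_; ∣_∣; Nonempty; Empty)
  renaming (_∈_ to _∈ₛ_; _∉_ to _∉ₛ_)
open import Data.Fin.Subset.Properties
  using (x∈⁅x⁆; x∈⁅y⁆⇒x≡y; x∈p∪q⁺; x∈p∪q⁻; x∈p∩q⁺; x∈p∩q⁻; p⊆p∪q; q⊆p∪q; ⊆⊤; ⊆-antisym; ∉⊥;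
         ∪-assoc; ∪-comm; ∪-identityˡ; ∪-identityʳ; ∣⊥∣≡0; ∣p∣≤n)
  renaming (_∈?_ to _∈ₛ?_)
open import Data.List.Base
  using (List; []; _∷_; _++_; map; length; filter; foldr; deduplicate;
         cartesianProduct; cartesianProductWith)
import Data.List.Membership.DecPropositional as DecMembership
open import Data.List.Membership.Propositional using (_∈_; find; lose)
open import Data.List.Membership.Propositional.Properties
  using (∈-map⁺; ∈-map⁻; ∈-++⁺ˡ; ∈-++⁺ʳ; ∈-++⁻; ∈-filter⁺; ∈-filter⁻; ∈-cartesianProductWith⁻)
open import Data.List.Properties
  using (length-filter; length-map; length-++; map-++; map-∘; map-cong-local; filter-all; filter-none)
open import Data.List.Relation.Unary.All as All using (All; []; _∷_; all?; tail)
import Data.List.Relation.Unary.All.Properties as All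
open import Data.List.Relation.Unary.Any using (Any; any?; here; there)
open import Data.List.Relation.Unary.Unique.Propositional using (Unique; []; _∷_)
import Data.List.Relation.Unary.Unique.Propositional.Properties as Unique
open import Data.Maybe.Base using (Maybe; just; nothing)
open import Data.Maybe.Properties using (just-injective)
open import Data.Nat.Base
  using (ℕ; zero; suc; _+_; _*_; _∸_; _^_; _⊔_; _≤_; _<_; z≤n; s≤s)
open import Data.Nat.Properties hiding (_≟_)
open import Data.Nat.Solver using (module +-*-Solver)
open import Data.Product.Base using (Σ-syntax; ∃-syntax; _×_; _,_; proj₁; proj₂)
open import Data.Sum.Base using (_⊎_; inj₁; inj₂)
open import Data.Unit.Base using (⊤)
open import Data.Vec.Base using (Vec; []; _∷_; lookup; toList; here; there)
open import Data.Vec.Properties using (length-toList)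
open import Data.Vec.Properties.WithK using ([]=-irrelevant)
open import Function.Base using (_∘_)
open import Function.Bundles using (_⇔_; mk⇔)
open import Relation.Binary.PropositionalEquality
open import Relation.Nullary
import Relation.Nullary.Decidable as Dec

-- The time bound has to be witnessed by evaluation derivations of a concrete program. The output of
-- each test in it is stated as `encodeBool (does p?)` for an ordinary decision procedure `p?`, so
-- correctness is proved for decidable predicates on lists, apart from the program. A cost is a
-- coefficient times a product with one factor per enclosing loop: nesting adds a factor, a cheaper
-- sequential part embeds into a larger product, and no recurrence has to be solved.
--
-- What makes single exponential time in |L| possible is that a stage remembers only which steps are
-- covered, not by whom. A family then has at most 2^|L| members however many users there are,
-- whereas there are |U|^|L| plans. Nothing is lost, since the next block is tested by itself: its
-- user is new, so a ≠ between the block and earlier steps holds automatically, and a = cannot leave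
-- the block because the block must contain both of its steps or neither.

private
  variable
    k v m n : ℕ

-- Running times

-- A list stands for the product of the successors of its entries, which makes
-- every unit of time positive.
Unit : Set
Unit = List ℕ

⟦_⟧ᵤ : Unit → ℕ
⟦ [] ⟧ᵤ    = 1
⟦ a ∷ U ⟧ᵤ = suc a * ⟦ U ⟧ᵤ

infix 4 _⊑_

-- As every factor is at least one, factors may be inserted or enlarged freely. This lets the cost
-- of an inner computation be quoted inside the budget of an outer one.
data _⊑_ : Unit → Unit → Set where
  []   : ∀ {V} → [] ⊑ V
  skip : ∀ {U V b} → U ⊑ V → U ⊑ b ∷ V
  _∷_  : ∀ {U V a b} → a ≤ b → U ⊑ V → a ∷ U ⊑ b ∷ V

unit-positive : ∀ U → 1 ≤ ⟦ U ⟧ᵤ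
unit-positive []      = ≤-refl
unit-positive (a ∷ U) = ≤-trans (unit-positive U) (m≤m+n ⟦ U ⟧ᵤ _)

⊑⇒≤ : ∀ {U V} → U ⊑ V → ⟦ U ⟧ᵤ ≤ ⟦ V ⟧ᵤ
⊑⇒≤ {V = V} []           = unit-positive V
⊑⇒≤ {V = b ∷ V} (skip p) = ≤-trans (⊑⇒≤ p) (m≤m+n ⟦ V ⟧ᵤ _)
⊑⇒≤ (a≤b ∷ p)            = *-mono-≤ (s≤s a≤b) (⊑⇒≤ p)

⊑-refl : ∀ {U} → U ⊑ U
⊑-refl {[]}    = []
⊑-refl {a ∷ U} = ≤-refl ∷ ⊑-refl

-- Passing from `a` to `suc a` adds exactly one copy of `⟦ U ⟧ᵤ`, which pays for one more round. The
-- same `J` occurs on both sides, so an induction over rounds closes.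
rec-cost : ∀ J U a {c t} → c ≤ J * ⟦ U ⟧ᵤ → t ≤ J * ⟦ a ∷ U ⟧ᵤ → c + t ≤ J * ⟦ suc a ∷ U ⟧ᵤ
rec-cost J U a p q =
  ≤-trans (+-mono-≤ p q) (≤-reflexive (sym (*-distribˡ-+ J ⟦ U ⟧ᵤ _)))

-- The time is split into a coefficient `j` and a unit `U`: the combinators below merely add
-- coefficients, which are mostly closed numerals, so that `upTo` can round them up by evaluation.
record Run (bs : Vec (Expr k 1) k) (γ : Vec Tree v) (e : Expr k v) (x : Tree)
           (j : ℕ) (U : Unit) : Set where
  constructor run
  field
    {time}     : ℕ
    derivation : bs , γ ⊢ e ⇓ x [ time ]
    time≤      : time ≤ j * ⟦ U ⟧ᵤ

open Run

module _ {bs : Vec (Expr k 1) k} where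

  private
    variable
      γ : Vec Tree v
      c e e₁ e₂ : Expr k v
      i j l : ℕ
      x y z : Tree
      U V : Unit

  suc-cost : ∀ {t} i U → t ≤ i * ⟦ U ⟧ᵤ → suc t ≤ suc i * ⟦ U ⟧ᵤ
  suc-cost i U p = +-mono-≤ (unit-positive U) p

  sum-cost : ∀ {t u} i j U → t ≤ i * ⟦ U ⟧ᵤ → u ≤ j * ⟦ U ⟧ᵤ → suc (t + u) ≤ suc (i + j) * ⟦ U ⟧ᵤ
  sum-cost i j U p q =
    suc-cost (i + j) U (≤-trans (+-mono-≤ p q) (≤-reflexive (sym (*-distribʳ-+ ⟦ U ⟧ᵤ i j))))

  varʳ : ∀ {i} → Run bs γ (var i) (lookup γ i) 1 U
  varʳ {U = U} = run var (suc-cost 0 U z≤n)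

  nilʳ : Run bs γ nil nil 1 U
  nilʳ {U = U} = run nil (suc-cost 0 U z≤n)

  infixr 6 _∙ʳ_

  _∙ʳ_ : Run bs γ e₁ x i U → Run bs γ e₂ y j U → Run bs γ (e₁ ∙ e₂) (x ∙ y) (suc (i + j)) U
  _∙ʳ_ {i = i} {U = U} {j = j} (run d p) (run d′ q) = run (d ∙ d′) (sum-cost i j U p q)

  case-nilʳ : Run bs γ c nil i U → Run bs γ e₁ z j U → Run bs γ (case c e₁ e₂) z (suc (i + j)) U
  case-nilʳ {i = i} {U = U} {j = j} (run d p) (run d′ q) = run (case-nil d d′) (sum-cost i j U p q)

  case-∙ʳ : Run bs γ c (x ∙ y) i U → Run bs (x ∷ y ∷ γ) e₂ z j U →
            Run bs γ (case c e₁ e₂) z (suc (i + j)) U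
  case-∙ʳ {i = i} {U = U} {j = j} (run d p) (run d′ q) = run (case-∙ d d′) (sum-cost i j U p q)

  letʳ : Run bs γ e₁ x i U → Run bs (x ∷ γ) e₂ y j U → Run bs γ (let′ e₁ e₂) y (suc (i + j)) U
  letʳ {i = i} {U = U} {j = j} (run d p) (run d′ q) = run (let′ d d′) (sum-cost i j U p q)

  callʳ : ∀ {f} → Run bs γ e x i U → Run bs (x ∷ []) (lookup bs f) y j U →
          Run bs γ (call f e) y (suc (i + j)) U
  callʳ {i = i} {U = U} {j = j} (run d p) (run d′ q) = run (call d d′) (sum-cost i j U p q)

  castʳ : x ≡ y → Run bs γ e x i U → Run bs γ e y i U
  castʳ refl r = r

  relax : i ≤ j → Run bs γ e x i U → Run bs γ e x j U
  relax {U = U} i≤j (run d p) = run d (≤-trans p (*-monoˡ-≤ ⟦ U ⟧ᵤ i≤j))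

  expand : ∀ U V c → ⟦ U ⟧ᵤ ≤ c * ⟦ V ⟧ᵤ → Run bs γ e x i U → Run bs γ e x (i * c) V
  expand {i = i} U V c U≤V (run d p) =
    run d (≤-trans p (≤-trans (*-monoʳ-≤ i U≤V) (≤-reflexive (sym (*-assoc i c ⟦ V ⟧ᵤ)))))

  -- Turns a coefficient that depends on the input into one more factor of the unit.
  absorb : ∀ c {N} → i ≤ suc N → Run bs γ e x (c * i) U → Run bs γ e x c (N ∷ U)
  absorb {i = i} {U = U} c {N} i≤ (run d p) = run d (≤-trans p
    (≤-trans (≤-reflexive (*-assoc c i ⟦ U ⟧ᵤ)) (*-monoʳ-≤ c (*-monoˡ-≤ ⟦ U ⟧ᵤ i≤))))

  rescale : ⟦ U ⟧ᵤ ≤ ⟦ V ⟧ᵤ → Run bs γ e x i U → Run bs γ e x i V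
  rescale {i = i} U≤V (run d p) = run d (≤-trans p (*-monoʳ-≤ i U≤V))

  scale : U ⊑ V → Run bs γ e x i U → Run bs γ e x i V
  scale U⊑V = rescale (⊑⇒≤ U⊑V)

  upTo : ∀ J {_ : True (i ≤? J)} → Run bs γ e x i U → Run bs γ e x J U
  upTo J {i≤J} = relax (toWitness i≤J)

  -- `g` is the result as a function of the tested bit, so one statement serves both branches. The
  -- costs of the branches are added, which gives the same coefficient for either value of `b`.
  boolʳ : ∀ (g : Bool → Tree) {b} → Run bs γ c (encodeBool b) i U →
          Run bs γ e₁ (g false) j U → Run bs (nil ∷ nil ∷ γ) e₂ (g true) l U →
          Run bs γ (case c e₁ e₂) (g b) (suc (i + (j + l))) U
  boolʳ {i = i} {j = j} {l = l} g {false} rc r₁ r₂ =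
    relax (s≤s (+-monoʳ-≤ i (m≤m+n j l))) (case-nilʳ rc r₁)
  boolʳ {i = i} {j = j} {l = l} g {true} rc r₁ r₂ =
    relax (s≤s (+-monoʳ-≤ i (m≤n+m l j))) (case-∙ʳ rc r₂)

-- The program

-- Structural recursion on the list in an argument of the form env ∙ list.
-- The cons case sees the variables result, head, tail, env, list, argument.
foldBody : Fin k → Expr k 3 → Expr k 6 → Expr k 1
foldBody f e₁ e₂ =
  case (var (# 0)) nil
    (case (var (# 1)) e₁
      (let′ (call f (var (# 2) ∙ var (# 1))) e₂))

module _ {bs : Vec (Expr k 1) k} (f : Fin k) {e₁ : Expr k 3} {e₂ : Expr k 6}
         (body : lookup bs f ≡ foldBody f e₁ e₂)
         {X : Set} (enc : X → Tree) (env : Tree) (g : List X → Tree)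
         (Q : List X → Set) (tail : ∀ {x xs} → Q (x ∷ xs) → Q xs)
         {i j : ℕ} {U : Unit}
         (nil-case : Run bs (env ∷ nil ∷ env ∙ nil ∷ []) e₁ (g []) i U)
         (cons-case : ∀ x xs → Q (x ∷ xs) →
            Run bs (g xs ∷ enc x ∷ encodeList enc xs ∷ env ∷ encodeList enc (x ∷ xs) ∷
                    env ∙ encodeList enc (x ∷ xs) ∷ []) e₂ (g (x ∷ xs)) j U)
         where

  -- All rounds are measured in one fixed unit `U`; `Q` carries the bounds that make a round fit
  -- into it and therefore has to pass to tails. A loop thus contributes exactly the factor
  -- `length xs ∷_`.
  foldʳ : ∀ xs → Q xs →
          Run bs (env ∙ encodeList enc xs ∷ []) (lookup bs f) (g xs) (10 + i + j) (length xs ∷ U)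
  foldʳ [] q rewrite body =
    rescale (≤-reflexive (sym (*-identityˡ ⟦ U ⟧ᵤ)))
      (relax (≤-trans (m≤n+m (4 + i) 6) (m≤m+n (10 + i) j))
        (case-∙ʳ {i = 1} varʳ (case-nilʳ varʳ nil-case)))
  foldʳ (x ∷ xs) q = unfold (foldʳ xs (tail q))
    where
    r = 10 + i + j

    -- The 9 units are two `case`s with their scrutinees, the `let′`, and the recursive call with
    -- its argument pair.
    cost : ∀ {t u} → t ≤ r * ⟦ length xs ∷ U ⟧ᵤ → u ≤ j * ⟦ U ⟧ᵤ →
           9 + (t + u) ≤ r * ⟦ suc (length xs) ∷ U ⟧ᵤ
    cost {t} {u} p q = begin
      9 + (t + u)                       ≡⟨ cong (9 +_) (+-comm t u) ⟩
      9 + (u + t)                       ≡⟨ +-assoc 9 u t ⟨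
      9 + u + t                         ≤⟨ rec-cost r U (length xs) 9+u≤ p ⟩
      r * ⟦ suc (length xs) ∷ U ⟧ᵤ      ∎
      where
      open ≤-Reasoning
      9+u≤ : 9 + u ≤ r * ⟦ U ⟧ᵤ
      9+u≤ = begin
        9 + u                     ≤⟨ +-mono-≤ (*-monoʳ-≤ 9 (unit-positive U)) q ⟩
        9 * ⟦ U ⟧ᵤ + j * ⟦ U ⟧ᵤ   ≡⟨ *-distribʳ-+ ⟦ U ⟧ᵤ 9 j ⟨
        (9 + j) * ⟦ U ⟧ᵤ          ≤⟨ *-monoˡ-≤ ⟦ U ⟧ᵤ (+-monoˡ-≤ j (≤-trans (n≤1+n 9) (m≤m+n 10 i))) ⟩
        r * ⟦ U ⟧ᵤ                ∎

    unfold : Run bs (env ∙ encodeList enc xs ∷ []) (lookup bs f) (g xs) r (length xs ∷ U) →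
             Run bs (env ∙ encodeList enc (x ∷ xs) ∷ []) (lookup bs f) (g (x ∷ xs)) r
               (suc (length xs) ∷ U)
    unfold (run d p) with run d′ p′ ← cons-case x xs q =
      subst (λ e → Run bs _ e _ _ _) (sym body)
        (run (case-∙ var (case-∙ var (let′ (call (var ∙ var) d) d′))) (cost p p′))

ν : ∀ i {n} {_ : True (suc i ≤? n)} → Expr k n
ν i {_} {i<n} = var (#_ i {m<n = i<n})

falseᵉ trueᵉ : Expr k v
falseᵉ = nil
trueᵉ  = nil ∙ nil

`equal `nth `member `authorized `respects `respectsAll `difference
  `eligible `extends `extensions `consAll `append `sublists `coverable
  `covered `solve `appendAll `product `executions `anySolvable `allSolvable : Fin 21
`equal       = # 0
`nth         = # 1
`member      = # 2
`authorized  = # 3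
`respects    = # 4
`respectsAll = # 5
`difference  = # 6
`eligible    = # 7
`extends     = # 8
`extensions  = # 9
`consAll     = # 10
`append      = # 11
`sublists    = # 12
`coverable   = # 13
`covered     = # 14
`solve       = # 15
`appendAll   = # 16
`product     = # 17
`executions  = # 18
`anySolvable = # 19
`allSolvable = # 20

bodies : Vec (Expr 21 1) 21
bodies =
  -- `equal : a ∙ b
    case (ν 0) nil
      (case (ν 0)
        (case (ν 1) trueᵉ falseᵉ)
        (case (ν 3) falseᵉ (call `equal (ν 3 ∙ ν 1))))
  -- `nth : i ∙ list
  ∷ case (ν 0) nil
      (case (ν 0)
        (case (ν 1) nil (ν 0))
        (case (ν 3) nil (call `nth (ν 3 ∙ ν 1))))
  -- `member : x ∙ Y
  ∷ foldBody `member falseᵉ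
      (case (call `equal (ν 3 ∙ ν 1)) (ν 0) trueᵉ)
  -- `authorized : (policy ∙ user) ∙ Y
  ∷ foldBody `authorized trueᵉ
      (case (ν 3) nil
        (case (call `nth (ν 1 ∙ call `nth (ν 3 ∙ ν 0))) falseᵉ (ν 4)))
  -- `respects : (L ∙ Y) ∙ constraint
  ∷ case (ν 0) nil (case (ν 0) nil (case (ν 3) nil (case (ν 1) nil
      -- An implication is a `case` on its premise whose nil branch answers true. Matching a true
      -- bit binds two variables, which shifts the indices by two each time. Below, `ν 6` is the
      -- encoded operation, with nil standing for ≠.
      (case (call `member (ν 0 ∙ ν 4)) trueᵉ
        (case (call `member (ν 3 ∙ ν 6)) trueᵉ
          (case (ν 6)
            (case (call `member (ν 4 ∙ ν 9)) trueᵉ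
              (case (call `member (ν 7 ∙ ν 11)) trueᵉ falseᵉ))
            (case
              (case (call `member (ν 6 ∙ ν 11)) trueᵉ (call `member (ν 9 ∙ ν 13)))
              falseᵉ
              (case (call `member (ν 9 ∙ ν 13)) trueᵉ (call `member (ν 10 ∙ ν 15))))))))))
  -- `respectsAll : (L ∙ Y) ∙ constraints
  ∷ foldBody `respectsAll trueᵉ
      (case (call `respects (ν 3 ∙ ν 1)) falseᵉ (ν 2))
  -- `difference : Y ∙ X
  ∷ foldBody `difference nil
      (case (call `member (ν 1 ∙ ν 3)) (ν 1 ∙ ν 0) (ν 2))
  -- `eligible : Y ∙ user ∙ L ∙ policy ∙ constraints
  ∷ case (ν 0) nil (case (ν 1) nil (case (ν 1) nil (case (ν 1) nil
      (case (call `authorized ((ν 0 ∙ ν 4) ∙ ν 6)) falseᵉ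
        (call `respectsAll ((ν 4 ∙ ν 8) ∙ ν 3))))))
  -- `extends : (X ∙ user ∙ L ∙ policy ∙ constraints) ∙ F
  ∷ foldBody `extends falseᵉ
      (case (ν 3) nil
        (case (call `eligible (call `difference (ν 3 ∙ ν 0) ∙ ν 1)) (ν 2) trueᵉ))
  -- `extensions : (F ∙ user ∙ L ∙ policy ∙ constraints) ∙ family
  ∷ foldBody `extensions nil
      (case (ν 3) nil
        (case (call `extends ((ν 3 ∙ ν 1) ∙ ν 0)) (ν 2) (ν 5 ∙ ν 4)))
  -- `consAll : x ∙ family
  ∷ foldBody `consAll nil ((ν 3 ∙ ν 1) ∙ ν 0)
  -- `append : ys ∙ xs
  ∷ foldBody `append (ν 0) (ν 1 ∙ ν 0)
  -- `sublists : nil ∙ L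
  ∷ foldBody `sublists (nil ∙ nil)
      (call `append (ν 0 ∙ call `consAll (ν 1 ∙ ν 0)))
  -- `coverable : (sublists ∙ L ∙ policy ∙ constraints) ∙ users
  ∷ foldBody `coverable (nil ∙ nil)
      (case (ν 3) nil (call `extensions ((ν 2 ∙ ν 4 ∙ ν 1) ∙ ν 0)))
  -- `covered : L ∙ F
  ∷ foldBody `covered falseᵉ
      (case (call `difference (ν 1 ∙ ν 3)) trueᵉ (ν 2))
  -- `solve : (policy ∙ constraints) ∙ L
  ∷ case (ν 0) nil (case (ν 0) nil (case (ν 0) nil
      (let′ (call `sublists (nil ∙ ν 5))
        (let′ (call `coverable ((ν 0 ∙ ν 6 ∙ ν 5) ∙ ν 1))
          (call `covered (ν 7 ∙ ν 0))))))
  -- `appendAll : X ∙ family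
  ∷ foldBody `appendAll nil (call `append (ν 1 ∙ ν 3) ∙ ν 0)
  -- `product : B ∙ A
  ∷ foldBody `product nil
      (call `append (ν 0 ∙ call `appendAll (ν 1 ∙ ν 3)))
  -- `executions : spec
  ∷ case (ν 0) nil
      (case (ν 0) ((ν 1 ∙ nil) ∙ nil)
        (case (ν 3) nil
          (let′ (call `executions (ν 0))
            (let′ (call `executions (ν 2))
              (case (ν 5) (call `product (ν 0 ∙ ν 1))
                (case (ν 1) (call `product (ν 2 ∙ ν 3))
                  (call `append (ν 4 ∙ ν 5))))))))
  -- `anySolvable : (policy ∙ constraints) ∙ Ls
  ∷ foldBody `anySolvable falseᵉ
      (case (call `solve (ν 3 ∙ ν 1)) (ν 0) trueᵉ)
  -- `allSolvable : (policy ∙ constraints) ∙ Ls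
  ∷ foldBody `allSolvable trueᵉ
      (case (call `solve (ν 3 ∙ ν 1)) falseᵉ (ν 2))
  ∷ []

Fun : Fin 21 → Tree → Tree → ℕ → Unit → Set
Fun f x y = Run bodies (x ∷ []) (lookup bodies f) y

-- The decision procedure and its running time

nthTree : Tree → Tree → Tree
nthTree nil     nil      = nil
nthTree nil     (x ∙ _)  = x
nthTree (_ ∙ i) nil      = nil
nthTree (_ ∙ i) (_ ∙ xs) = nthTree i xs

-- Any tree serves as the unary number given by the length of its right
-- spine, so that a tail of a row of the policy names a user.
spine : Tree → ℕ
spine nil     = 0
spine (_ ∙ x) = suc (spine x)

equalʳ : ∀ {m} (s t : Fin m) →
         Fun `equal (encodeFin s ∙ encodeFin t) (encodeBool (does (s ≟ t))) 10 (toℕ s ∷ [])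
equalʳ zero    zero    = upTo 10 (case-∙ʳ varʳ (case-nilʳ varʳ (case-nilʳ varʳ (nilʳ ∙ʳ nilʳ))))
equalʳ zero    (suc t) = upTo 10 (case-∙ʳ varʳ (case-nilʳ varʳ (case-∙ʳ varʳ nilʳ)))
equalʳ (suc s) zero    = upTo 10 (case-∙ʳ varʳ (case-∙ʳ varʳ (case-nilʳ varʳ nilʳ)))
equalʳ (suc s) (suc t) with run d p ← equalʳ s t =
  run (case-∙ var (case-∙ var (case-∙ var (call (var ∙ var) d))))
    (rec-cost 10 [] (toℕ s) ≤-refl p)

nthʳ : ∀ i xs → Fun `nth (i ∙ xs) (nthTree i xs) 10 (spine i ∷ [])
nthʳ nil     nil      = upTo 10 (case-∙ʳ varʳ (case-nilʳ varʳ (case-nilʳ varʳ nilʳ)))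
nthʳ nil     (_ ∙ _)  = upTo 10 (case-∙ʳ varʳ (case-nilʳ varʳ (case-∙ʳ varʳ varʳ)))
nthʳ (_ ∙ i) nil      = scale (z≤n ∷ []) (upTo 10 (case-∙ʳ varʳ (case-∙ʳ varʳ (case-nilʳ varʳ nilʳ))))
nthʳ (_ ∙ i) (_ ∙ xs) with run d p ← nthʳ i xs =
  run (case-∙ var (case-∙ var (case-∙ var (call (var ∙ var) d))))
    (rec-cost 10 [] (spine i) ≤-refl p)

encodeSet : ∀ {m} → List (Fin m) → Tree
encodeSet = encodeList encodeFin

encodeFamily : ∀ {m} → List (List (Fin m)) → Tree
encodeFamily = encodeList encodeSet

-- Users are natural numbers here because the stages are counted by them. Out of range the answer is
-- `false`, in agreement with the `nil` that `nthTree` returns there.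
bitAt : ∀ {n} → ℕ → Subset n → Bool
bitAt _       []      = false
bitAt zero    (b ∷ p) = b
bitAt (suc i) (b ∷ p) = bitAt i p

nthTree-bit : ∀ {n} w (p : Subset n) → nthTree w (encodeSubset p) ≡ encodeBool (bitAt (spine w) p)
nthTree-bit nil     []      = refl
nthTree-bit (_ ∙ w) []      = refl
nthTree-bit nil     (b ∷ p) = refl
nthTree-bit (_ ∙ w) (b ∷ p) = nthTree-bit w p

nthTree-lookup : ∀ {m} {X : Set} (f : X → Tree) (i : Fin m) (xs : Vec X m) →
                 nthTree (encodeFin i) (encodeList f (toList xs)) ≡ f (lookup xs i)
nthTree-lookup f zero    (x ∷ xs) = refl
nthTree-lookup f (suc i) (x ∷ xs) = nthTree-lookup f i xs

spine-encodeFin : ∀ {m} (i : Fin m) → spine (encodeFin i) ≡ toℕ i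
spine-encodeFin zero    = refl
spine-encodeFin (suc i) = cong suc (spine-encodeFin i)

spine-encodeList : ∀ {X : Set} (f : X → Tree) xs → spine (encodeList f xs) ≡ length xs
spine-encodeList f []       = refl
spine-encodeList f (x ∷ xs) = cong suc (spine-encodeList f xs)

-- Brings one step of `filter` into the form `g b` that `boolʳ` expects.
filter-∷ : ∀ {X : Set} {P : X → Set} (P? : ∀ x → Dec (P x)) x xs →
           filter P? (x ∷ xs) ≡ (if does (P? x) then x ∷ filter P? xs else filter P? xs)
filter-∷ P? x xs with does (P? x)
... | true  = refl
... | false = refl

-- With `P` and `Q` the membership of two steps in one block of the partition: = wants both or
-- neither in the block, ≠ not both. Imposed on all blocks, this is the original constraint.
Agree : Op → Set → Set → Set
Agree eq  P Q = (P → Q) × (Q → P)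
Agree neq P Q = P → ¬ Q

agree? : ∀ o {P Q} → Dec P → Dec Q → Dec (Agree o P Q)
agree? eq  p? q? = (p? →-dec q?) ×-dec (q? →-dec p?)
agree? neq p? q? = p? →-dec ¬? q?

sublists : ∀ {X : Set} → List X → List (List X)
sublists []       = [] ∷ []
sublists (x ∷ xs) = map (x ∷_) (sublists xs) ++ sublists xs

length-sublists : ∀ {X : Set} (xs : List X) → length (sublists xs) ≡ 2 ^ length xs
length-sublists []       = refl
length-sublists (x ∷ xs) = begin
  length (map (x ∷_) (sublists xs) ++ sublists xs)           ≡⟨ length-++ (map (x ∷_) (sublists xs)) ⟩
  length (map (x ∷_) (sublists xs)) + length (sublists xs)   ≡⟨ cong₂ _+_
                                                                  (trans (length-map (x ∷_) (sublists xs)) ih) ih ⟩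
  2 ^ length xs + 2 ^ length xs                              ≡⟨ cong (2 ^ length xs +_) (+-identityʳ _) ⟨
  2 ^ suc (length xs)                                        ∎
  where
  open ≡-Reasoning
  ih = length-sublists xs

sublists-shorter : ∀ {X : Set} (xs : List X) → All (λ ys → length ys ≤ length xs) (sublists xs)
sublists-shorter []       = z≤n ∷ []
sublists-shorter (x ∷ xs) =
  All.++⁺ (All.map⁺ (All.map s≤s (sublists-shorter xs))) (All.map m≤n⇒m≤1+n (sublists-shorter xs))

null? : ∀ {X : Set} (xs : List X) → Dec (xs ≡ [])
null? []      = yes refl
null? (_ ∷ _) = no λ()

module _ {m : ℕ} where
  open DecMembership (_≟_ {m}) public using (_∈?_)

  infixl 7 _∖_

  _∖_ : List (Fin m) → List (Fin m) → List (Fin m)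
  X ∖ Y = filter (λ x → ¬? (x ∈? Y)) X

module Algorithm {m n : ℕ} (policy : Vec (Subset n) m) (C : List (Op × Fin m × Fin m)) where

  Authorizedᵘ : ℕ → Fin m → Set
  Authorizedᵘ u t = T (bitAt u (lookup policy t))

  -- The two premises on `L` mirror the derived workflow, which drops every constraint that mentions
  -- a step outside the execution set.
  Respects : List (Fin m) → List (Fin m) → Op × Fin m × Fin m → Set
  Respects L Y (o , s , s′) = s ∈ L → s′ ∈ L → Agree o (s ∈ Y) (s′ ∈ Y)

  respects? : ∀ L Y c → Dec (Respects L Y c)
  respects? L Y (o , s , s′) = (s ∈? L) →-dec (s′ ∈? L) →-dec agree? o (s ∈? Y) (s′ ∈? Y)

  Eligible : ℕ → List (Fin m) → List (Fin m) → Set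
  Eligible u L Y = All (Authorizedᵘ u) Y × All (Respects L Y) C

  eligible? : ∀ u L Y → Dec (Eligible u L Y)
  eligible? u L Y = all? (λ t → T? (bitAt u (lookup policy t))) Y ×-dec all? (respects? L Y) C

  extends? : ∀ u L F X → Dec (Any (λ X′ → Eligible u L (X ∖ X′)) F)
  extends? u L F X = any? (λ X′ → eligible? u L (X ∖ X′)) F

  -- Sublists of L that the users 0 , … , j ∸ 1 can execute, built one user
  -- at a time.
  coverable : List (Fin m) → ℕ → List (List (Fin m))
  coverable L zero    = [] ∷ []
  coverable L (suc j) = filter (extends? j L (coverable L j)) (sublists L)

  coverable-length : ∀ L j → length (coverable L j) ≤ 2 ^ length L
  coverable-length L zero    = ^-monoʳ-≤ 2 {0} {length L} z≤n
  coverable-length L (suc j) =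
    ≤-trans (length-filter (extends? j L (coverable L j)) (sublists L))
      (≤-reflexive (length-sublists L))

  coverable-shorter : ∀ L j → All (λ X → length X ≤ length L) (coverable L j)
  coverable-shorter L zero    = z≤n ∷ []
  coverable-shorter L (suc j) = All.filter⁺ (extends? j L (coverable L j)) (sublists-shorter L)

  Solvable : List (Fin m) → Set
  Solvable L = Any (λ X → L ∖ X ≡ []) (coverable L n)

  solvable? : ∀ L → Dec (Solvable L)
  solvable? L = any? (λ X → null? (L ∖ X)) (coverable L n)

-- Running times of the operations on lists and families

appendʳ : ∀ {X : Set} (enc : X → Tree) xs ys →
          Fun `append (encodeList enc ys ∙ encodeList enc xs) (encodeList enc (xs ++ ys))
            20 (length xs ∷ [])
appendʳ enc xs ys = upTo 20
  (foldʳ `append refl enc (encodeList enc ys) (λ xs → encodeList enc (xs ++ ys)) (λ _ → ⊤) _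
    varʳ
    (λ _ _ _ → varʳ ∙ʳ varʳ)
    xs _)

consAllʳ : ∀ {X : Set} (enc : X → Tree) x F →
           Fun `consAll (enc x ∙ encodeList (encodeList enc) F)
             (encodeList (encodeList enc) (map (x ∷_) F)) 20 (length F ∷ [])
consAllʳ enc x F = upTo 20
  (foldʳ `consAll refl (encodeList enc) (enc x)
    (λ F → encodeList (encodeList enc) (map (x ∷_) F)) (λ _ → ⊤) _
    nilʳ
    (λ _ _ _ → (varʳ ∙ʳ varʳ) ∙ʳ varʳ)
    F _)

sublistsʳ : ∀ {X : Set} (enc : X → Tree) xs →
            Fun `sublists (nil ∙ encodeList enc xs) (encodeList (encodeList enc) (sublists xs))
              80 (length xs ∷ 2 ^ length xs ∷ [])
sublistsʳ enc xs = upTo 80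
  (foldʳ `sublists refl enc nil (λ ys → encodeList (encodeList enc) (sublists ys))
    -- The families of all tails are bounded by that of the whole list, so that a single unit is
    -- valid in every round.
    (λ ys → 2 ^ length ys ≤ 2 ^ length xs) (λ {_} {ys} → ≤-trans (^-monoʳ-≤ 2 (n≤1+n (length ys))))
    (nilʳ ∙ʳ nilʳ)
    (λ y ys p → let q = ≤-trans (≤-reflexive (length-sublists ys))
                          (≤-trans (^-monoʳ-≤ 2 (n≤1+n (length ys))) p) in
      callʳ (varʳ ∙ʳ callʳ (varʳ ∙ʳ varʳ) (scale (q ∷ []) (consAllʳ enc y (sublists ys))))
        (scale (≤-trans (≤-reflexive (length-map (y ∷_) (sublists ys))) q ∷ [])
          (appendʳ (encodeList enc) (map (y ∷_) (sublists ys)) (sublists ys))))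
    xs ≤-refl)

appendAllʳ : ∀ {X : Set} (enc : X → Tree) N xs F → length xs ≤ N →
             Fun `appendAll (encodeList enc xs ∙ encodeList (encodeList enc) F)
               (encodeList (encodeList enc) (map (xs ++_) F)) 60 (length F ∷ N ∷ [])
appendAllʳ enc N xs F xs≤N = upTo 60
  (foldʳ `appendAll refl (encodeList enc) (encodeList enc xs)
    (λ F → encodeList (encodeList enc) (map (xs ++_) F)) (λ _ → ⊤) _
    nilʳ
    (λ ys _ _ → callʳ (varʳ ∙ʳ varʳ) (scale (xs≤N ∷ []) (appendʳ enc xs ys)) ∙ʳ varʳ)
    F _)

productʳ : ∀ {X : Set} (enc : X → Tree) N F G → All (λ xs → length xs ≤ N) F →
           Fun `product (encodeList (encodeList enc) G ∙ encodeList (encodeList enc) F)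
             (encodeList (encodeList enc) (cartesianProductWith _++_ F G))
             120 (length F ∷ length G ∷ N ∷ [])
productʳ enc N F G F≤N = upTo 120
  (foldʳ `product refl (encodeList enc) (encodeList (encodeList enc) G)
    (λ F → encodeList (encodeList enc) (cartesianProductWith _++_ F G))
    (All (λ xs → length xs ≤ N)) tail
    nilʳ
    (λ { xs F (xs≤N ∷ _) →
      callʳ (varʳ ∙ʳ callʳ (varʳ ∙ʳ varʳ) (appendAllʳ enc N xs G xs≤N))
        (scale (≤-reflexive (length-map (xs ++_) G) ∷ [])
          (appendʳ (encodeList enc) (map (xs ++_) G) (cartesianProductWith _++_ F G))) })
    F F≤N)

-- Running times of the tests, with `N` bounding the numbers of steps, users and constraints

module Running {m n : ℕ} (policy : Vec (Subset n) m) (C : List (Op × Fin m × Fin m))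
               (N : ℕ) (m≤N : m ≤ N) (n≤N : n ≤ N) (C≤N : length C ≤ N) where

  open Algorithm policy C

  policyᵗ constraintsᵗ : Tree
  policyᵗ      = encodeList encodeSubset (toList policy)
  constraintsᵗ = encodeList encodeConstraint C

  Small : List (Fin m) → Set
  Small X = length X ≤ N

  toℕ≤N : ∀ (s : Fin m) → toℕ s ≤ N
  toℕ≤N s = ≤-trans (<⇒≤ (Fin.toℕ<n s)) m≤N

  memberʳ : ∀ s Y → Small Y →
            Fun `member (encodeFin s ∙ encodeSet Y) (encodeBool (does (s ∈? Y))) 50 (N ∷ N ∷ [])
  memberʳ s Y Y≤N = scale (Y≤N ∷ ⊑-refl) (upTo 50
    (foldʳ `member refl encodeFin (encodeFin s) (λ Y → encodeBool (does (s ∈? Y))) (λ _ → ⊤) _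
      nilʳ
      (λ y Y _ → boolʳ (λ b → encodeBool (b ∨ does (s ∈? Y)))
        (callʳ (varʳ ∙ʳ varʳ) (scale (toℕ≤N s ∷ []) (equalʳ s y)))
        varʳ
        (nilʳ ∙ʳ nilʳ))
      Y _))

  authorizedʳ : ∀ w {u} → spine w ≡ u → u ≤ N → ∀ Y → Small Y →
                Fun `authorized ((policyᵗ ∙ w) ∙ encodeSet Y)
                  (encodeBool (does (all? (λ t → T? (bitAt u (lookup policy t))) Y)))
                  100 (N ∷ N ∷ [])
  authorizedʳ w refl w≤N Y Y≤N = scale (Y≤N ∷ ⊑-refl) (upTo 100
    (foldʳ `authorized refl encodeFin (policyᵗ ∙ w)
      (λ Y → encodeBool (does (all? auth? Y))) (λ _ → ⊤) _
      (nilʳ ∙ʳ nilʳ)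
      (λ t Y _ → case-∙ʳ varʳ
        (boolʳ (λ b → encodeBool (b ∧ does (all? auth? Y)))
          (callʳ (varʳ ∙ʳ callʳ (varʳ ∙ʳ varʳ)
              (castʳ (nthTree-lookup encodeSubset t policy)
                (scale (≤-trans (≤-reflexive (spine-encodeFin t)) (toℕ≤N t) ∷ [])
                  (nthʳ (encodeFin t) policyᵗ))))
            (castʳ (nthTree-bit w (lookup policy t))
              (scale (w≤N ∷ []) (nthʳ w (encodeSubset (lookup policy t))))))
          nilʳ
          varʳ))
      Y _))
    where
    auth? : ∀ t → Dec (Authorizedᵘ (spine w) t)
    auth? t = T? (bitAt (spine w) (lookup policy t))

  differenceʳ : ∀ X Y → Small X → Small Y →
                Fun `difference (encodeSet Y ∙ encodeSet X) (encodeSet (X ∖ Y)) 100 (N ∷ N ∷ N ∷ [])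
  differenceʳ X Y X≤N Y≤N = scale (X≤N ∷ ⊑-refl) (upTo 100
    (foldʳ `difference refl encodeFin (encodeSet Y) (λ X → encodeSet (X ∖ Y)) (λ _ → ⊤) _
      nilʳ
      (λ x X _ → castʳ (cong encodeSet (sym (filter-∷ (λ x → ¬? (x ∈? Y)) x X)))
        (boolʳ (λ b → encodeSet (if not b then x ∷ X ∖ Y else X ∖ Y))
          (callʳ (varʳ ∙ʳ varʳ) (memberʳ x Y Y≤N))
          (varʳ ∙ʳ varʳ)
          varʳ))
      X _))

  module _ (L : List (Fin m)) (L≤N : Small L) where

    respectsʳ : ∀ Y → Small Y → ∀ c →
                Fun `respects ((encodeSet L ∙ encodeSet Y) ∙ encodeConstraint c)
                  (encodeBool (does (respects? L Y c))) 500 (N ∷ N ∷ [])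
    respectsʳ Y Y≤N (o , s , s′) =
      upTo 500 (case-∙ʳ varʳ (case-∙ʳ varʳ (case-∙ʳ varʳ (case-∙ʳ varʳ
        (implies (callʳ (varʳ ∙ʳ varʳ) (memberʳ s L L≤N))
          (implies (callʳ (varʳ ∙ʳ varʳ) (memberʳ s′ L L≤N))
            (agree o)))))))
      where
      -- `not b ∨ b′` is the value to which `does` of `_→-dec_` reduces.
      implies : ∀ {w} {γ : Vec Tree w} {c e b b′ i j} → Run bodies γ c (encodeBool b) i (N ∷ N ∷ []) →
                Run bodies (nil ∷ nil ∷ γ) e (encodeBool b′) j (N ∷ N ∷ []) →
                Run bodies γ (case c trueᵉ e) (encodeBool (not b ∨ b′)) (suc (i + (3 + j))) (N ∷ N ∷ [])
      implies {b′ = b′} r r′ = boolʳ (λ b → encodeBool (not b ∨ b′)) r (nilʳ ∙ʳ nilʳ) r′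

      agree : ∀ o {γ : Vec Tree 3} → let P? = s ∈? Y; Q? = s′ ∈? Y in
              Run bodies
                (nil ∷ nil ∷ nil ∷ nil ∷ encodeFin s ∷ encodeFin s′ ∷ encodeOp o ∷
                 encodeFin s ∙ encodeFin s′ ∷ encodeSet L ∷ encodeSet Y ∷ γ)
                (case (ν 6)
                  (case (call `member (ν 4 ∙ ν 9)) trueᵉ
                    (case (call `member (ν 7 ∙ ν 11)) trueᵉ falseᵉ))
                  (case
                    (case (call `member (ν 6 ∙ ν 11)) trueᵉ (call `member (ν 9 ∙ ν 13)))
                    falseᵉ
                    (case (call `member (ν 9 ∙ ν 13)) trueᵉ (call `member (ν 10 ∙ ν 15)))))
                (encodeBool (does (agree? o P? Q?))) 300 (N ∷ N ∷ [])
      agree eq = upTo 300 (case-∙ʳ varʳ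
        (boolʳ (λ b → encodeBool (b ∧ does ((s′ ∈? Y) →-dec (s ∈? Y))))
          (implies (callʳ (varʳ ∙ʳ varʳ) (memberʳ s Y Y≤N)) (callʳ (varʳ ∙ʳ varʳ) (memberʳ s′ Y Y≤N)))
          nilʳ
          (implies (callʳ (varʳ ∙ʳ varʳ) (memberʳ s′ Y Y≤N)) (callʳ (varʳ ∙ʳ varʳ) (memberʳ s Y Y≤N)))))
      agree neq = upTo 300 (case-nilʳ varʳ
        (implies (callʳ (varʳ ∙ʳ varʳ) (memberʳ s Y Y≤N))
          (boolʳ (λ b → encodeBool (not b)) (callʳ (varʳ ∙ʳ varʳ) (memberʳ s′ Y Y≤N))
            (nilʳ ∙ʳ nilʳ) nilʳ)))

    respectsAllʳ : ∀ Y → Small Y →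
                   Fun `respectsAll ((encodeSet L ∙ encodeSet Y) ∙ constraintsᵗ)
                     (encodeBool (does (all? (respects? L Y) C))) 600 (N ∷ N ∷ N ∷ [])
    respectsAllʳ Y Y≤N = scale (C≤N ∷ ⊑-refl) (upTo 600
      (foldʳ `respectsAll refl encodeConstraint (encodeSet L ∙ encodeSet Y)
        (λ C → encodeBool (does (all? (respects? L Y) C))) (λ _ → ⊤) _
        (nilʳ ∙ʳ nilʳ)
        (λ c C _ → boolʳ (λ b → encodeBool (b ∧ does (all? (respects? L Y) C)))
          (callʳ (varʳ ∙ʳ varʳ) (respectsʳ Y Y≤N c))
          nilʳ
          varʳ)
        C _))

    context : Tree
    context = encodeSet L ∙ policyᵗ ∙ constraintsᵗ

    module _ (w : Tree) {u : ℕ} (w≡u : spine w ≡ u) (u≤N : u ≤ N) where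

      eligibleʳ : ∀ Y → Small Y →
                  Fun `eligible (encodeSet Y ∙ w ∙ context) (encodeBool (does (eligible? u L Y)))
                    800 (N ∷ N ∷ N ∷ [])
      eligibleʳ Y Y≤N = upTo 800
        (case-∙ʳ varʳ (case-∙ʳ varʳ (case-∙ʳ varʳ (case-∙ʳ varʳ
          (boolʳ (λ b → encodeBool (b ∧ does (all? (respects? L Y) C)))
            (callʳ ((varʳ ∙ʳ varʳ) ∙ʳ varʳ) (scale (skip ⊑-refl) (authorizedʳ w w≡u u≤N Y Y≤N)))
            nilʳ
            (callʳ ((varʳ ∙ʳ varʳ) ∙ʳ varʳ) (respectsAllʳ Y Y≤N)))))))

      extendsʳ : ∀ X F → Small X → All Small F →
                 Fun `extends ((encodeSet X ∙ w ∙ context) ∙ encodeFamily F)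
                   (encodeBool (does (extends? u L F X))) 1000 (length F ∷ N ∷ N ∷ N ∷ [])
      extendsʳ X F X≤N F≤N = upTo 1000
        (foldʳ `extends refl encodeSet (encodeSet X ∙ w ∙ context)
          (λ F → encodeBool (does (extends? u L F X))) (All Small) tail
          nilʳ
          (λ { X′ F (X′≤N ∷ _) → case-∙ʳ varʳ
            (boolʳ (λ b → encodeBool (b ∨ does (extends? u L F X)))
              (callʳ
                (callʳ (varʳ ∙ʳ varʳ) (differenceʳ X X′ X≤N X′≤N) ∙ʳ varʳ)
                (eligibleʳ (X ∖ X′) (≤-trans (length-filter _ X) X≤N)))
              varʳ
              (nilʳ ∙ʳ nilʳ)) })
          F F≤N)

      extensionsʳ : ∀ F Xs → All Small F → All Small Xs →
                    Fun `extensions ((encodeFamily F ∙ w ∙ context) ∙ encodeFamily Xs)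
                      (encodeFamily (filter (extends? u L F) Xs))
                      1100 (length Xs ∷ length F ∷ N ∷ N ∷ N ∷ [])
      extensionsʳ F Xs F≤N Xs≤N = upTo 1100
        (foldʳ `extensions refl encodeSet (encodeFamily F ∙ w ∙ context)
          (λ Xs → encodeFamily (filter (extends? u L F) Xs)) (All Small) tail
          nilʳ
          (λ { X Xs (X≤N ∷ _) →
            castʳ (cong encodeFamily (sym (filter-∷ (extends? u L F) X Xs)))
              (case-∙ʳ varʳ
                (boolʳ (λ b → encodeFamily (if b then X ∷ filter (extends? u L F) Xs
                                                 else filter (extends? u L F) Xs))
                  (callʳ ((varʳ ∙ʳ varʳ) ∙ʳ varʳ) (extendsʳ X F X≤N F≤N))
                  varʳ
                  (varʳ ∙ʳ varʳ))) })
          Xs Xs≤N)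

    coverableʳ : ∀ us → length us ≤ N →
                 Fun `coverable
                   ((encodeFamily (sublists L) ∙ context) ∙ encodeList encodeBool us)
                   (encodeFamily (coverable L (length us)))
                   1200 (N ∷ 2 ^ length L ∷ 2 ^ length L ∷ N ∷ N ∷ N ∷ [])
    coverableʳ us us≤N = scale (us≤N ∷ ⊑-refl) (upTo 1200
      (foldʳ `coverable refl encodeBool (encodeFamily (sublists L) ∙ context)
        (λ us → encodeFamily (coverable L (length us))) (λ us → length us ≤ N) (≤-trans (n≤1+n _))
        (nilʳ ∙ʳ nilʳ)
        (λ _ us us<N → case-∙ʳ varʳ
          (callʳ ((varʳ ∙ʳ varʳ ∙ʳ varʳ) ∙ʳ varʳ)
            (scale
              (≤-reflexive (length-sublists L) ∷
               coverable-length L (length us) ∷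
               ⊑-refl)
              -- The tail `us` of the row itself names the user of this round, since its spine is
              -- `length us`. The innermost round handles user 0.
              (extensionsʳ (encodeList encodeBool us) (spine-encodeList encodeBool us)
                (≤-trans (n≤1+n _) us<N) (coverable L (length us)) (sublists L)
                (All.map (λ p → ≤-trans p L≤N) (coverable-shorter L (length us)))
                (All.map (λ p → ≤-trans p L≤N) (sublists-shorter L))))))
        us us≤N))

    coveredʳ : ∀ F → All Small F →
               Fun `covered (encodeSet L ∙ encodeFamily F)
                 (encodeBool (does (any? (λ X → null? (L ∖ X)) F)))
                 200 (length F ∷ N ∷ N ∷ N ∷ [])
    coveredʳ F F≤N = upTo 200
      (foldʳ `covered refl encodeSet (encodeSet L)
        (λ F → encodeBool (does (any? (λ X → null? (L ∖ X)) F))) (All Small) tail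
        nilʳ
        (λ { X F (X≤N ∷ _) → isNull (L ∖ X) (callʳ (varʳ ∙ʳ varʳ) (differenceʳ L X L≤N X≤N)) })
        F F≤N)
      where
      isNull : ∀ {b x y z w v i} (Z : List (Fin m)) {U} →
               Run bodies (encodeBool b ∷ x ∷ y ∷ z ∷ w ∷ v ∷ []) (call `difference (ν 1 ∙ ν 3))
                 (encodeSet Z) i U →
               Run bodies (encodeBool b ∷ x ∷ y ∷ z ∷ w ∷ v ∷ [])
                 (case (call `difference (ν 1 ∙ ν 3)) trueᵉ (ν 2))
                 (encodeBool (does (null? Z) ∨ b)) (suc (i + 3)) U
      isNull         []      r = case-nilʳ r (nilʳ ∙ʳ nilʳ)
      isNull {i = i} (_ ∷ _) r = relax (s≤s (+-monoʳ-≤ i (s≤s z≤n))) (case-∙ʳ r varʳ)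

  -- The argument in `Fin m` guarantees that the policy has a row, from which the program learns how
  -- many users there are.
  solveʳ : Fin m → ∀ L → Small L →
           Fun `solve ((policyᵗ ∙ constraintsᵗ) ∙ encodeSet L) (encodeBool (does (solvable? L)))
             2000 (N ∷ 2 ^ length L ∷ 2 ^ length L ∷ N ∷ N ∷ N ∷ [])
  solveʳ s L L≤N = go policy refl s
    where
    K = 2 ^ length L

    -- The first row of the policy lists the users.
    go : ∀ {m′} (p : Vec (Subset n) m′) → encodeList encodeSubset (toList p) ≡ policyᵗ → Fin m′ →
         Fun `solve ((policyᵗ ∙ constraintsᵗ) ∙ encodeSet L) (encodeBool (does (solvable? L)))
           2000 (N ∷ K ∷ K ∷ N ∷ N ∷ N ∷ [])
    go (row ∷ _) p≡ _ = upTo 2000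
      (case-∙ʳ varʳ (case-∙ʳ varʳ (case-∙ʳ {x = encodeSubset row} (castʳ (sym p≡) varʳ)
        (letʳ
          (callʳ (nilʳ ∙ʳ varʳ) (scale (L≤N ∷ ≤-refl ∷ []) (sublistsʳ encodeFin L)))
          (letʳ
            (callʳ ((varʳ ∙ʳ varʳ ∙ʳ varʳ) ∙ʳ varʳ)
              (coverableʳ L L≤N (toList row) (≤-trans (≤-reflexive (length-toList row)) n≤N)))
            (callʳ (varʳ ∙ʳ varʳ)
              (castʳ (cong (λ j → encodeBool (does (any? (λ X → null? (L ∖ X)) (coverable L j))))
                       (length-toList row))
                (scale (skip (skip (coverable-length L (length (toList row)) ∷ ⊑-refl)))
                  (coveredʳ L L≤N (coverable L (length (toList row)))
                    (All.map (λ p → ≤-trans p L≤N) (coverable-shorter L (length (toList row)))))))))))))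

  module _ (s : Fin m) (b : ℕ) where

    Bounded : List (Fin m) → Set
    Bounded L = Small L × length L ≤ b

    -- The loops from the outside in: users, candidate sublists, members of the previous family, and
    -- a cubic factor for forming a difference and testing its eligibility.
    budget : Unit
    budget = N ∷ 2 ^ b ∷ 2 ^ b ∷ N ∷ N ∷ N ∷ []

    solve-boundedʳ : ∀ L → Bounded L →
                     Fun `solve ((policyᵗ ∙ constraintsᵗ) ∙ encodeSet L)
                       (encodeBool (does (solvable? L))) 2000 budget
    solve-boundedʳ L (L≤N , L≤b) =
      scale (≤-refl ∷ ^-monoʳ-≤ 2 L≤b ∷ ^-monoʳ-≤ 2 L≤b ∷ ⊑-refl) (solveʳ s L L≤N)

    anySolvableʳ : ∀ Ls → All Bounded Ls →
                   Fun `anySolvable ((policyᵗ ∙ constraintsᵗ) ∙ encodeFamily Ls)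
                     (encodeBool (does (any? solvable? Ls))) 2100 (length Ls ∷ budget)
    anySolvableʳ Ls Ls≤ = upTo 2100
      (foldʳ `anySolvable refl encodeSet (policyᵗ ∙ constraintsᵗ)
        (λ Ls → encodeBool (does (any? solvable? Ls))) (All Bounded) tail
        nilʳ
        (λ { L Ls (L≤ ∷ _) → boolʳ (λ b → encodeBool (b ∨ does (any? solvable? Ls)))
          (callʳ (varʳ ∙ʳ varʳ) (solve-boundedʳ L L≤)) varʳ (nilʳ ∙ʳ nilʳ) })
        Ls Ls≤)

    allSolvableʳ : ∀ Ls → All Bounded Ls →
                   Fun `allSolvable ((policyᵗ ∙ constraintsᵗ) ∙ encodeFamily Ls)
                     (encodeBool (does (all? solvable? Ls))) 2100 (length Ls ∷ budget)
    allSolvableʳ Ls Ls≤ = upTo 2100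
      (foldʳ `allSolvable refl encodeSet (policyᵗ ∙ constraintsᵗ)
        (λ Ls → encodeBool (does (all? solvable? Ls))) (All Bounded) tail
        (nilʳ ∙ʳ nilʳ)
        (λ { L Ls (L≤ ∷ _) → boolʳ (λ b → encodeBool (b ∧ does (all? solvable? Ls)))
          (callʳ (varʳ ∙ʳ varʳ) (solve-boundedʳ L L≤)) nilʳ varʳ })
        Ls Ls≤)

-- Execution sets

toSubset : List (Fin m) → Subset m
toSubset []      = ⊥
toSubset (x ∷ X) = ⁅ x ⁆ ∪ toSubset X

∈-toSubset⁺ : ∀ {x} {X : List (Fin m)} → x ∈ X → x ∈ₛ toSubset X
∈-toSubset⁺ {x = x} (here refl) = p⊆p∪q _ (x∈⁅x⁆ x)
∈-toSubset⁺ (there p)           = q⊆p∪q _ _ (∈-toSubset⁺ p)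

∈-toSubset⁻ : ∀ {x} (X : List (Fin m)) → x ∈ₛ toSubset X → x ∈ X
∈-toSubset⁻ []      p = ⊥-elim (∉⊥ p)
∈-toSubset⁻ (y ∷ X) p with x∈p∪q⁻ ⁅ y ⁆ (toSubset X) p
... | inj₁ q = here (x∈⁅y⁆⇒x≡y y q)
... | inj₂ q = there (∈-toSubset⁻ X q)

toSubset-++ : ∀ (X Y : List (Fin m)) → toSubset (X ++ Y) ≡ toSubset X ∪ toSubset Y
toSubset-++ []      Y = sym (∪-identityˡ (toSubset Y))
toSubset-++ (x ∷ X) Y =
  trans (cong (⁅ x ⁆ ∪_) (toSubset-++ X Y)) (sym (∪-assoc ⁅ x ⁆ (toSubset X) (toSubset Y)))

∣⁅x⁆∪p∣ : ∀ (x : Fin m) p → x ∉ₛ p → ∣ ⁅ x ⁆ ∪ p ∣ ≡ suc ∣ p ∣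
∣⁅x⁆∪p∣ zero    (true  ∷ p) x∉p = ⊥-elim (x∉p here)
∣⁅x⁆∪p∣ zero    (false ∷ p) x∉p = cong (suc ∘ ∣_∣) (∪-identityˡ p)
∣⁅x⁆∪p∣ (suc x) (true  ∷ p) x∉p = cong suc (∣⁅x⁆∪p∣ x p (x∉p ∘ there))
∣⁅x⁆∪p∣ (suc x) (false ∷ p) x∉p = ∣⁅x⁆∪p∣ x p (x∉p ∘ there)

∣toSubset∣ : ∀ (X : List (Fin m)) → Unique X → ∣ toSubset X ∣ ≡ length X
∣toSubset∣ {m} []      _           = ∣⊥∣≡0 m
∣toSubset∣     (x ∷ X) u@(_ ∷ uX) =
  trans (∣⁅x⁆∪p∣ x (toSubset X) (Unique.Unique[x∷xs]⇒x∉xs u ∘ ∈-toSubset⁻ X)) (cong suc (∣toSubset∣ X uX))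

-- The program handles execution sets as lists of steps, with concatenation for union. Disjointness
-- of the components keeps these lists free of repetitions, so their lengths are the cardinalities
-- that ♭ measures.
executions : Spec m → List (List (Fin m))
executions (step s)        = (s ∷ []) ∷ []
executions (W₁ ⨾ W₂ ⟨ _ ⟩) = cartesianProductWith _++_ (executions W₁) (executions W₂)
executions (W₁ ∥ W₂ ⟨ _ ⟩) = cartesianProductWith _++_ (executions W₁) (executions W₂)
executions (W₁ ⊕ W₂ ⟨ _ ⟩) = executions W₁ ++ executions W₂

map-toSubset-product : ∀ (F G : List (List (Fin m))) →
  cartesianProductWith _∪_ (map toSubset F) (map toSubset G) ≡
  map toSubset (cartesianProductWith _++_ F G)
map-toSubset-product []      G = refl
map-toSubset-product (X ∷ F) G = begin
  map (toSubset X ∪_) (map toSubset G) ++ cartesianProductWith _∪_ (map toSubset F) (map toSubset G)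
    ≡⟨ cong₂ _++_
         (trans (sym (map-∘ G))
           (trans (map-cong-local (All.universal (sym ∘ toSubset-++ X) G)) (map-∘ G)))
         (map-toSubset-product F G) ⟩
  map toSubset (map (X ++_) G) ++ map toSubset (cartesianProductWith _++_ F G)
    ≡⟨ map-++ toSubset (map (X ++_) G) _ ⟨
  map toSubset (map (X ++_) G ++ cartesianProductWith _++_ F G) ∎
  where open ≡-Reasoning

executionSets≡ : ∀ (W : Spec m) → executionSets W ≡ map toSubset (executions W)
executionSets≡ (step s)        = cong (_∷ []) (sym (∪-identityʳ ⁅ s ⁆))
executionSets≡ (W₁ ⨾ W₂ ⟨ _ ⟩) =
  trans (cong₂ (cartesianProductWith _∪_) (executionSets≡ W₁) (executionSets≡ W₂))
    (map-toSubset-product (executions W₁) (executions W₂))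
executionSets≡ (W₁ ∥ W₂ ⟨ _ ⟩) =
  trans (cong₂ (cartesianProductWith _∪_) (executionSets≡ W₁) (executionSets≡ W₂))
    (map-toSubset-product (executions W₁) (executions W₂))
executionSets≡ (W₁ ⊕ W₂ ⟨ _ ⟩) =
  trans (cong₂ _++_ (executionSets≡ W₁) (executionSets≡ W₂))
    (sym (map-++ toSubset (executions W₁) (executions W₂)))

-- `inhabited` serves uniqueness under ⊕: sets contained in two disjoint step sets can coincide only
-- if they are empty.
record Lists (W : Spec m) (X : List (Fin m)) : Set where
  field
    unique   : Unique X
    ⊆steps   : toSubset X ⊆ steps W
    inhabited : Nonempty (toSubset X)

open Lists

lists-++ : ∀ (W₁ W₂ : Spec m) → Empty (steps W₁ ∩ steps W₂) → ∀ {X Y} →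
           Lists W₁ X → Lists W₂ Y →
           Unique (X ++ Y) × toSubset (X ++ Y) ⊆ steps W₁ ∪ steps W₂ × Nonempty (toSubset (X ++ Y))
lists-++ W₁ W₂ disjoint {X} {Y} p q =
  Unique.++⁺ (unique p) (unique q)
    (λ (x∈X , x∈Y) → disjoint (_ , x∈p∩q⁺ (⊆steps p (∈-toSubset⁺ x∈X) , ⊆steps q (∈-toSubset⁺ x∈Y)))) ,
  (λ x∈ → x∈p∪q⁺ (split (∈-++⁻ X (∈-toSubset⁻ (X ++ Y) x∈)))) ,
  (let x , x∈X = inhabited p in x , ∈-toSubset⁺ (∈-++⁺ˡ (∈-toSubset⁻ X x∈X)))
  where
  split : ∀ {x} → x ∈ X ⊎ x ∈ Y → x ∈ₛ steps W₁ ⊎ x ∈ₛ steps W₂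
  split (inj₁ x∈X) = inj₁ (⊆steps p (∈-toSubset⁺ x∈X))
  split (inj₂ x∈Y) = inj₂ (⊆steps q (∈-toSubset⁺ x∈Y))

execution-lists : ∀ (W : Spec m) {X} → X ∈ executions W → Lists W X
execution-lists (step s) (here refl) = record
  { unique   = [] ∷ []
  ; ⊆steps   = λ {x} x∈ → subst (x ∈ₛ_) (∪-identityʳ ⁅ s ⁆) x∈
  ; inhabited = s , ∈-toSubset⁺ {X = s ∷ []} (here refl)
  }
execution-lists (W₁ ⨾ W₂ ⟨ d ⟩) X∈
  with _ , _ , Y∈ , Z∈ , refl ← ∈-cartesianProductWith⁻ _++_ (executions W₁) (executions W₂) X∈
  = let u , s , e = lists-++ W₁ W₂ d (execution-lists W₁ Y∈) (execution-lists W₂ Z∈) in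
    record { unique = u ; ⊆steps = s ; inhabited = e }
execution-lists (W₁ ∥ W₂ ⟨ d ⟩) X∈
  with _ , _ , Y∈ , Z∈ , refl ← ∈-cartesianProductWith⁻ _++_ (executions W₁) (executions W₂) X∈
  = let u , s , e = lists-++ W₁ W₂ d (execution-lists W₁ Y∈) (execution-lists W₂ Z∈) in
    record { unique = u ; ⊆steps = s ; inhabited = e }
execution-lists (W₁ ⊕ W₂ ⟨ d ⟩) X∈ with ∈-++⁻ (executions W₁) X∈
... | inj₁ X∈₁ = let p = execution-lists W₁ X∈₁ in
  record { unique = unique p ; ⊆steps = p⊆p∪q _ ∘ ⊆steps p ; inhabited = inhabited p }
... | inj₂ X∈₂ = let p = execution-lists W₂ X∈₂ in
  record { unique = unique p ; ⊆steps = q⊆p∪q _ _ ∘ ⊆steps p ; inhabited = inhabited p }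

executionSet-props : ∀ (W : Spec m) {S} → S ∈ executionSets W → S ⊆ steps W × Nonempty S
executionSet-props W S∈
  with X , X∈ , refl ← ∈-map⁻ toSubset (subst (_ ∈_) (executionSets≡ W) S∈)
  = let p = execution-lists W X∈ in ⊆steps p , inhabited p

-- Enumeration without repetition, and the sizes ♯ and ♭

module _ {A B C : Set} (f : A → B → C) (g : C → A) (h : C → B) where

  map-retract : ∀ xs ys → (∀ {x y} → x ∈ xs → y ∈ ys → (g (f x y) , h (f x y)) ≡ (x , y)) →
                map (λ z → g z , h z) (cartesianProductWith f xs ys) ≡ cartesianProduct xs ys
  map-retract []       ys p = refl
  map-retract (x ∷ xs) ys p = begin
    map pair (map (f x) ys ++ cartesianProductWith f xs ys)
      ≡⟨ map-++ pair (map (f x) ys) _ ⟩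
    map pair (map (f x) ys) ++ map pair (cartesianProductWith f xs ys)
      ≡⟨ cong₂ _++_ (trans (sym (map-∘ ys)) (map-cong-local (All.tabulate (p (here refl)))))
           (map-retract xs ys (p ∘ there)) ⟩
    map (x ,_) ys ++ cartesianProduct xs ys ∎
    where
    open ≡-Reasoning
    pair : C → A × B
    pair z = g z , h z

  -- `f` is injective only on the given lists. Mapping its results back by `g` and `h` yields the
  -- plain Cartesian product, and uniqueness is pulled back along that map.
  cartesianProductWith-unique : ∀ {xs ys} →
    (∀ {x y} → x ∈ xs → y ∈ ys → (g (f x y) , h (f x y)) ≡ (x , y)) →
    Unique xs → Unique ys → Unique (cartesianProductWith f xs ys)
  cartesianProductWith-unique {xs} {ys} p uxs uys =
    Unique.map⁻ (subst Unique (sym (map-retract xs ys p)) (Unique.cartesianProduct⁺ uxs uys))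

∪-∩-cancel : ∀ {p q r : Subset m} → p ⊆ r → Empty (r ∩ q) → (p ∪ q) ∩ r ≡ p
∪-∩-cancel {p = p} {q} {r} p⊆r r∩q=∅ = ⊆-antisym to λ x∈p → x∈p∩q⁺ (p⊆p∪q q x∈p , p⊆r x∈p)
  where
  to : (p ∪ q) ∩ r ⊆ p
  to x∈ with x∈p∪q , x∈r ← x∈p∩q⁻ (p ∪ q) r x∈ with x∈p∪q⁻ p q x∈p∪q
  ... | inj₁ x∈p = x∈p
  ... | inj₂ x∈q = ⊥-elim (r∩q=∅ (_ , x∈p∩q⁺ (x∈r , x∈q)))

-- Intersecting with the step set of a component recovers the part of the execution set that came
-- from it.
executionSets-product-unique : ∀ (W₁ W₂ : Spec m) → Empty (steps W₁ ∩ steps W₂) →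
  Unique (executionSets W₁) → Unique (executionSets W₂) →
  Unique (cartesianProductWith _∪_ (executionSets W₁) (executionSets W₂))
executionSets-product-unique W₁ W₂ d =
  cartesianProductWith-unique _∪_ (_∩ steps W₁) (_∩ steps W₂) λ {S₁} {S₂} S₁∈ S₂∈ →
    let S₁⊆ , _ = executionSet-props W₁ S₁∈
        S₂⊆ , _ = executionSet-props W₂ S₂∈
    in cong₂ _,_
      (∪-∩-cancel S₁⊆ λ (x , x∈) → let a , b = x∈p∩q⁻ _ S₂ x∈ in d (x , x∈p∩q⁺ (a , S₂⊆ b)))
      (trans (cong (_∩ steps W₂) (∪-comm S₁ S₂))
        (∪-∩-cancel S₂⊆ λ (x , x∈) → let a , b = x∈p∩q⁻ _ S₁ x∈ in d (x , x∈p∩q⁺ (S₁⊆ b , a))))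

executionSets-unique : ∀ (W : Spec m) → Unique (executionSets W)
executionSets-unique (step s)        = [] ∷ []
executionSets-unique (W₁ ⨾ W₂ ⟨ d ⟩) =
  executionSets-product-unique W₁ W₂ d (executionSets-unique W₁) (executionSets-unique W₂)
executionSets-unique (W₁ ∥ W₂ ⟨ d ⟩) =
  executionSets-product-unique W₁ W₂ d (executionSets-unique W₁) (executionSets-unique W₂)
executionSets-unique (W₁ ⊕ W₂ ⟨ d ⟩) =
  Unique.++⁺ (executionSets-unique W₁) (executionSets-unique W₂) λ (S∈₁ , S∈₂) →
    let S⊆₁ , x , x∈S = executionSet-props W₁ S∈₁
        S⊆₂ , _       = executionSet-props W₂ S∈₂
    in d (x , x∈p∩q⁺ (S⊆₁ x∈S , S⊆₂ x∈S))

deduplicate-unique : ∀ (xs : List (Subset m)) → Unique xs → deduplicate _≟ₛ_ xs ≡ xs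
deduplicate-unique []       _          = refl
deduplicate-unique (x ∷ xs) (x∉ ∷ uxs) = cong (x ∷_)
  (trans (cong (filter (¬? ∘ (x ≟ₛ_))) (deduplicate-unique xs uxs)) (filter-all _ x∉))

-- The deduplication in ♯ removes nothing, so the list that the program builds without deduplicating
-- has exactly as many entries as the bound allows.
♯≡length : ∀ (W : Spec m) → ♯ W ≡ length (executions W)
♯≡length W = begin
  length (deduplicate _≟ₛ_ (executionSets W))   ≡⟨ cong length (deduplicate-unique _ (executionSets-unique W)) ⟩
  length (executionSets W)                      ≡⟨ cong length (executionSets≡ W) ⟩
  length (map toSubset (executions W))          ≡⟨ length-map toSubset (executions W) ⟩
  length (executions W)                         ∎
  where open ≡-Reasoning

∈⇒≤maximum : ∀ {A : Set} (f : A → ℕ) {x xs} → x ∈ xs → f x ≤ foldr _⊔_ 0 (map f xs)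
∈⇒≤maximum f {xs = x ∷ xs} (here refl) = m≤m⊔n (f x) _
∈⇒≤maximum f {xs = x ∷ xs} (there p)   = ≤-trans (∈⇒≤maximum f p) (m≤n⊔m (f x) _)

execution-length≤♭ : ∀ (W : Spec m) {X} → X ∈ executions W → length X ≤ ♭ W
execution-length≤♭ W {X} X∈ = subst (_≤ ♭ W) (∣toSubset∣ X (unique (execution-lists W X∈)))
  (∈⇒≤maximum ∣_∣ (subst (toSubset X ∈_) (sym (executionSets≡ W)) (∈-map⁺ toSubset X∈)))

execution-length≤m : ∀ (W : Spec m) {X} → X ∈ executions W → length X ≤ m
execution-length≤m {m} W {X} X∈ =
  subst (_≤ m) (∣toSubset∣ X (unique (execution-lists W X∈))) (∣p∣≤n (toSubset X))

length-product : ∀ {A B C : Set} (f : A → B → C) xs ys →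
                 length (cartesianProductWith f xs ys) ≡ length xs * length ys
length-product f []       ys = refl
length-product f (x ∷ xs) ys =
  trans (length-++ (map (f x) ys)) (cong₂ _+_ (length-map (f x) ys) (length-product f xs ys))

executions-nonempty : ∀ (W : Spec m) → 1 ≤ length (executions W)
executions-nonempty (step s)        = ≤-refl
executions-nonempty (W₁ ⨾ W₂ ⟨ _ ⟩) =
  subst (1 ≤_) (sym (length-product _++_ (executions W₁) (executions W₂)))
    (*-mono-≤ (executions-nonempty W₁) (executions-nonempty W₂))
executions-nonempty (W₁ ∥ W₂ ⟨ _ ⟩) =
  subst (1 ≤_) (sym (length-product _++_ (executions W₁) (executions W₂)))
    (*-mono-≤ (executions-nonempty W₁) (executions-nonempty W₂))
executions-nonempty (W₁ ⊕ W₂ ⟨ _ ⟩) =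
  subst (1 ≤_) (sym (length-++ (executions W₁)))
    (≤-trans (executions-nonempty W₁) (m≤m+n _ _))

-- Running time of the enumeration

suc≤2* : ∀ {a} → 1 ≤ a → suc a ≤ 2 * a
suc≤2* {a} 1≤a = ≤-trans (+-monoˡ-≤ a 1≤a) (≤-reflexive (cong (a +_) (sym (+-identityʳ a))))

-- Units multiply successors, but the output has `a * b` entries. Replacing each of the two
-- successors by a doubling accounts for the 4.
product-unit : ∀ {a b} N → 1 ≤ a → 1 ≤ b → ⟦ a ∷ b ∷ N ∷ [] ⟧ᵤ ≤ 4 * ⟦ a * b ∷ N ∷ [] ⟧ᵤ
product-unit {a} {b} N 1≤a 1≤b = begin
  suc a * (suc b * w)       ≤⟨ *-mono-≤ (suc≤2* 1≤a) (*-monoˡ-≤ w (suc≤2* 1≤b)) ⟩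
  2 * a * (2 * b * w)       ≡⟨ solve 3 (λ a b w → con 2 :* a :* (con 2 :* b :* w) := con 4 :* (a :* b :* w)) refl a b w ⟩
  4 * (a * b * w)           ≤⟨ *-monoʳ-≤ 4 (*-monoˡ-≤ w (n≤1+n (a * b))) ⟩
  4 * (suc (a * b) * w)     ∎
  where
  open ≤-Reasoning
  open +-*-Solver
  w = ⟦ N ∷ [] ⟧ᵤ

-- A composition node makes the encoding strictly larger than its two parts together. The one
-- additional `c` gained in this way pays for the `12 + k` units of overhead, `k` being the cost of
-- combining the two families.
branch-cost : ∀ c s₁ s₂ t k → 12 + k ≤ c →
              9 + (c * s₁ + (3 + (c * s₂ + k))) ≤ c * suc (t + suc (s₁ + s₂))
branch-cost c s₁ s₂ t k k≤c = begin
  9 + (c * s₁ + (3 + (c * s₂ + k)))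
    ≡⟨ solve 3 (λ x y k → con 9 :+ (x :+ (con 3 :+ (y :+ k))) := con 12 :+ k :+ (x :+ y)) refl (c * s₁) (c * s₂) k ⟩
  12 + k + (c * s₁ + c * s₂)       ≤⟨ +-monoˡ-≤ (c * s₁ + c * s₂) k≤c ⟩
  c + (c * s₁ + c * s₂)            ≡⟨ cong (c +_) (*-distribˡ-+ c s₁ s₂) ⟨
  c + c * (s₁ + s₂)                ≡⟨ *-suc c (s₁ + s₂) ⟨
  c * suc (s₁ + s₂)                ≤⟨ *-monoʳ-≤ c (≤-trans (m≤n+m _ t) (n≤1+n _)) ⟩
  c * suc (t + suc (s₁ + s₂))      ∎
  where
  open ≤-Reasoning
  open +-*-Solver

module _ {m : ℕ} (N : ℕ) (m≤N : m ≤ N) where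

  executions-productʳ : ∀ (W₁ W₂ : Spec m) →
    Fun `product (encodeFamily (executions W₂) ∙ encodeFamily (executions W₁))
      (encodeFamily (cartesianProductWith _++_ (executions W₁) (executions W₂)))
      480 (length (cartesianProductWith _++_ (executions W₁) (executions W₂)) ∷ N ∷ [])
  executions-productʳ W₁ W₂
    rewrite length-product _++_ (executions W₁) (executions W₂) =
    expand {i = 120} (a ∷ b ∷ N ∷ []) (a * b ∷ N ∷ []) 4 (product-unit N (executions-nonempty W₁) (executions-nonempty W₂))
      (productʳ encodeFin N (executions W₁) (executions W₂)
        (All.tabulate (λ X∈ → ≤-trans (execution-length≤m W₁ X∈) m≤N)))
    where
    a = length (executions W₁)
    b = length (executions W₂)

  product-lengthˡ : ∀ (W₁ W₂ : Spec m) →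
    length (executions W₁) ≤ length (cartesianProductWith _++_ (executions W₁) (executions W₂))
  product-lengthˡ W₁ W₂ rewrite length-product _++_ (executions W₁) (executions W₂) =
    ≤-trans (≤-reflexive (sym (*-identityʳ _)))
      (*-monoʳ-≤ (length (executions W₁)) (executions-nonempty W₂))

  product-lengthʳ : ∀ (W₁ W₂ : Spec m) →
    length (executions W₂) ≤ length (cartesianProductWith _++_ (executions W₁) (executions W₂))
  product-lengthʳ W₁ W₂ rewrite length-product _++_ (executions W₁) (executions W₂) =
    ≤-trans (≤-reflexive (sym (*-identityˡ _)))
      (*-monoˡ-≤ (length (executions W₂)) (executions-nonempty W₁))

  -- The coefficient counts nodes, while the unit is the length of the final list. The families of
  -- both components fit into that unit because no family is empty, so a product is at least as long
  -- as each of its factors.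
  executionsʳ : ∀ (W : Spec m) →
    Fun `executions (encodeSpec W) (encodeFamily (executions W))
      (600 * size (encodeSpec W)) (length (executions W) ∷ N ∷ [])
  executionsʳ (step s) = relax (m≤m*n 600 (size (encodeSpec (step s)))) (upTo 600
    (case-∙ʳ varʳ (case-nilʳ varʳ ((varʳ ∙ʳ nilʳ) ∙ʳ nilʳ))))
  -- The argument 3, like 5 and 7 in the other two compositions, is the size of the constructor tag;
  -- 512 is `12 + k` for `k = 500`.
  executionsʳ (W₁ ⨾ W₂ ⟨ _ ⟩) = relax (branch-cost 600 s₁ s₂ 3 500 (m≤m+n 512 88))
    (case-∙ʳ varʳ (case-∙ʳ varʳ (case-∙ʳ varʳ
      (letʳ (callʳ varʳ (scale (product-lengthˡ W₁ W₂ ∷ ⊑-refl) (executionsʳ W₁)))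
        (letʳ (callʳ varʳ (scale (product-lengthʳ W₁ W₂ ∷ ⊑-refl) (executionsʳ W₂)))
          (upTo 500 (case-nilʳ varʳ
            (callʳ (varʳ ∙ʳ varʳ) (executions-productʳ W₁ W₂)))))))))
    where
    s₁ = size (encodeSpec W₁)
    s₂ = size (encodeSpec W₂)
  executionsʳ (W₁ ∥ W₂ ⟨ _ ⟩) = relax (branch-cost 600 s₁ s₂ 5 500 (m≤m+n 512 88))
    (case-∙ʳ varʳ (case-∙ʳ varʳ (case-∙ʳ varʳ
      (letʳ (callʳ varʳ (scale (product-lengthˡ W₁ W₂ ∷ ⊑-refl) (executionsʳ W₁)))
        (letʳ (callʳ varʳ (scale (product-lengthʳ W₁ W₂ ∷ ⊑-refl) (executionsʳ W₂)))
          (upTo 500 (case-∙ʳ varʳ (case-nilʳ varʳ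
            (callʳ (varʳ ∙ʳ varʳ) (executions-productʳ W₁ W₂))))))))))
    where
    s₁ = size (encodeSpec W₁)
    s₂ = size (encodeSpec W₂)
  executionsʳ (W₁ ⊕ W₂ ⟨ _ ⟩) = relax (branch-cost 600 s₁ s₂ 7 500 (m≤m+n 512 88))
    (case-∙ʳ varʳ (case-∙ʳ varʳ (case-∙ʳ varʳ
      (letʳ (callʳ varʳ (scale (F≤ ∷ ⊑-refl) (executionsʳ W₁)))
        (letʳ (callʳ varʳ (scale (G≤ ∷ ⊑-refl) (executionsʳ W₂)))
          (upTo 500 (case-∙ʳ varʳ (case-∙ʳ varʳ
            (callʳ (varʳ ∙ʳ varʳ)
              (scale (F≤ ∷ []) (appendʳ encodeSet (executions W₁) (executions W₂))))))))))))
    where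
    s₁ = size (encodeSpec W₁)
    s₂ = size (encodeSpec W₂)
    F≤ : length (executions W₁) ≤ length (executions W₁ ++ executions W₂)
    F≤ = ≤-trans (m≤m+n _ _) (≤-reflexive (sym (length-++ (executions W₁))))
    G≤ : length (executions W₂) ≤ length (executions W₁ ++ executions W₂)
    G≤ = ≤-trans (m≤n+m _ _) (≤-reflexive (sym (length-++ (executions W₁))))

-- Correctness of the decision procedure

bitAt⁺ : ∀ {u : Fin n} {p} → u ∈ₛ p → T (bitAt (toℕ u) p)
bitAt⁺ here      = _
bitAt⁺ (there p) = bitAt⁺ p

bitAt⁻ : ∀ i (p : Subset n) → T (bitAt i p) → ∃[ u ] toℕ u ≡ i × u ∈ₛ p
bitAt⁻ zero    (true ∷ p) _ = zero , refl , here
bitAt⁻ (suc i) (_ ∷ p)    b with u , refl , u∈p ← bitAt⁻ i p b = suc u , refl , there u∈p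

-- Makes the steps of the first users under a plan a literal member of the candidate family, with no
-- reordering to account for.
filter-∈-sublists : ∀ {X : Set} {P : X → Set} (P? : ∀ x → Dec (P x)) xs → filter P? xs ∈ sublists xs
filter-∈-sublists P? []       = here refl
filter-∈-sublists P? (x ∷ xs) with does (P? x)
... | true  = ∈-++⁺ˡ (∈-map⁺ (x ∷_) (filter-∈-sublists P? xs))
... | false = ∈-++⁺ʳ (map (x ∷_) (sublists xs)) (filter-∈-sublists P? xs)

∈-∖⁻ : ∀ {t} (X Y : List (Fin m)) → t ∈ X ∖ Y → t ∈ X × ¬ t ∈ Y
∈-∖⁻ X Y = ∈-filter⁻ (λ x → ¬? (x ∈? Y)) {xs = X}

∈-∖⁺ : ∀ {t} {X Y : List (Fin m)} → t ∈ X → ¬ t ∈ Y → t ∈ X ∖ Y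
∈-∖⁺ {Y = Y} = ∈-filter⁺ (λ x → ¬? (x ∈? Y))

module Correctness (policy : Vec (Subset n) m) (C : List (Op × Fin m × Fin m)) (L : List (Fin m)) where

  open Algorithm policy C

  -- A valid plan freed from membership proofs: `user` is total, and only its values on `L` are
  -- constrained.
  record Assignment : Set where
    field
      user       : Fin m → Fin n
      authorized : ∀ {t} → t ∈ L → user t ∈ₛ lookup policy t
      satisfies  : All (λ (o , s , s′) → s ∈ L → s′ ∈ L → ⟦ o ⟧ (user s) (user s′)) C

  module _ (σ : Assignment) where
    open Assignment σ

    private
      before? : ∀ j t → Dec (toℕ (user t) < j)
      before? j t = toℕ (user t) <? j

      prefix : ℕ → List (Fin m)
      prefix j = filter (before? j) L

      new : ℕ → List (Fin m)
      new j = prefix (suc j) ∖ prefix j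

      ∈-new⁻ : ∀ {j t} → t ∈ new j → t ∈ L × toℕ (user t) ≡ j
      ∈-new⁻ {j} t∈ =
        let t∈₁ , t∉₂ = ∈-∖⁻ (prefix (suc j)) (prefix j) t∈
            t∈L , t<  = ∈-filter⁻ (before? (suc j)) {xs = L} t∈₁
        in t∈L , ≤∧≮⇒≡ (≤-pred t<) (t∉₂ ∘ ∈-filter⁺ (before? j) t∈L)

      ∈-new⁺ : ∀ {j t} → t ∈ L → toℕ (user t) ≡ j → t ∈ new j
      ∈-new⁺ {j} t∈L refl =
        ∈-∖⁺ (∈-filter⁺ (before? (suc j)) t∈L ≤-refl)
          (λ t∈ → <-irrefl refl (proj₂ (∈-filter⁻ (before? j) {xs = L} t∈)))

      new-eligible : ∀ j → Eligible j L (new j)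
      new-eligible j =
        All.tabulate (λ t∈ → let t∈L , t≡ = ∈-new⁻ t∈ in
          subst (λ i → T (bitAt i (lookup policy _))) t≡ (bitAt⁺ (authorized t∈L))) ,
        All.map (λ {c} → respects c) satisfies
        where
        respects : ∀ c → let (o , s , s′) = c in
                   (s ∈ L → s′ ∈ L → ⟦ o ⟧ (user s) (user s′)) → Respects L (new j) c
        respects (eq  , s , s′) h s∈ s′∈ =
          (λ s∈Y  → ∈-new⁺ s′∈ (trans (cong toℕ (sym (h s∈ s′∈))) (proj₂ (∈-new⁻ s∈Y)))) ,
          (λ s′∈Y → ∈-new⁺ s∈ (trans (cong toℕ (h s∈ s′∈)) (proj₂ (∈-new⁻ s′∈Y))))
        respects (neq , s , s′) h s∈ s′∈ s∈Y s′∈Y =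
          h s∈ s′∈ (Fin.toℕ-injective (trans (proj₂ (∈-new⁻ s∈Y)) (sym (proj₂ (∈-new⁻ s′∈Y)))))

      prefix-coverable : ∀ j → prefix j ∈ coverable L j
      prefix-coverable zero    = here (filter-none (before? 0) (All.universal (λ _ ()) L))
      prefix-coverable (suc j) =
        ∈-filter⁺ (extends? j L (coverable L j)) (filter-∈-sublists (before? (suc j)) L)
          (lose (prefix-coverable j) (new-eligible j))

    assignment⇒solvable : Solvable L
    assignment⇒solvable = lose (prefix-coverable n)
      (filter-none (λ x → ¬? (x ∈? prefix n)) {xs = L}
        (All.tabulate λ t∈L t∉ → t∉ (∈-filter⁺ (before? n) t∈L (Fin.toℕ<n _))))

  -- `nothing` marks a step not yet assigned. Under = two steps are assigned together or not at all;
  -- under ≠ only two assigned steps can be in conflict.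
  Compatible : Op → Maybe ℕ → Maybe ℕ → Set
  Compatible eq  x y = x ≡ y
  Compatible neq x y = ∀ i → x ≡ just i → ¬ y ≡ just i

  -- An assignment of the users below j to a superset of X that is a union
  -- of =-classes of L.
  record Partial (j : ℕ) (X : List (Fin m)) : Set where
    field
      user       : Fin m → Maybe ℕ
      covers     : ∀ {t} → t ∈ X → ∃[ i ] user t ≡ just i
      authorized : ∀ {t i} → user t ≡ just i → i < j × T (bitAt i (lookup policy t))
      satisfies  : All (λ (o , s , s′) → s ∈ L → s′ ∈ L → Compatible o (user s) (user s′)) C

  -- User `j` takes over all of `X ∖ X′`, perhaps including steps outside `X′` that an earlier user
  -- already had. This is consistent because the block is a union of =-classes of `L`, so equal
  -- steps change hands together.
  extend : ∀ {j X X′} → Partial j X′ → Eligible j L (X ∖ X′) → Partial (suc j) X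
  extend {j} {X} {X′} π (auth , resp) = record
    { user       = user′
    ; covers     = covers′
    ; authorized = authorized′
    ; satisfies  = All.zipWith (λ {c} (h , r) → satisfies′ c h r) (satisfies , resp)
    }
    where
    open Partial π

    Y : List (Fin m)
    Y = X ∖ X′

    user′ : Fin m → Maybe ℕ
    user′ t = if does (t ∈? Y) then just j else user t

    covers′ : ∀ {t} → t ∈ X → ∃[ i ] user′ t ≡ just i
    covers′ {t} t∈X with t ∈? Y
    ... | yes _  = j , refl
    ... | no t∉Y with t ∈? X′
    ...   | yes t∈X′ = covers t∈X′
    ...   | no t∉X′  = ⊥-elim (t∉Y (∈-∖⁺ t∈X t∉X′))

    authorized′ : ∀ {t i} → user′ t ≡ just i → i < suc j × T (bitAt i (lookup policy t))
    authorized′ {t} u≡ with t ∈? Y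
    authorized′ refl | yes t∈Y = ≤-refl , All.lookup auth t∈Y
    ... | no _ = let i<j , b = authorized u≡ in m≤n⇒m≤1+n i<j , b

    satisfies′ : ∀ c → let (o , s , s′) = c in
                 (s ∈ L → s′ ∈ L → Compatible o (user s) (user s′)) → Respects L Y c →
                 s ∈ L → s′ ∈ L → Compatible o (user′ s) (user′ s′)
    satisfies′ (eq , s , s′) h r s∈ s′∈ with s ∈? Y | s′ ∈? Y
    ... | yes _   | yes _    = refl
    ... | yes s∈Y | no s′∉Y  = ⊥-elim (s′∉Y (proj₁ (r s∈ s′∈) s∈Y))
    ... | no s∉Y  | yes s′∈Y = ⊥-elim (s∉Y (proj₂ (r s∈ s′∈) s′∈Y))
    ... | no _    | no _     = h s∈ s′∈
    satisfies′ (neq , s , s′) h r s∈ s′∈ i s≡ s′≡ with s ∈? Y | s′ ∈? Y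
    ... | yes s∈Y | yes s′∈Y = r s∈ s′∈ s∈Y s′∈Y
    ... | no _    | no _     = h s∈ s′∈ i s≡ s′≡
    -- Earlier users are all below `j`, so a step of the new block cannot share its user with a step
    -- outside it.
    satisfies′ (neq , s , s′) h r s∈ s′∈ i refl s′≡ | yes _ | no _ = <-irrefl refl (proj₁ (authorized s′≡))
    satisfies′ (neq , s , s′) h r s∈ s′∈ i s≡ refl | no _ | yes _ = <-irrefl refl (proj₁ (authorized s≡))

  coverable⇒partial : ∀ j {X} → X ∈ coverable L j → Partial j X
  coverable⇒partial zero (here refl) = record
    { user = λ _ → nothing ; covers = λ () ; authorized = λ () ; satisfies = All.universal none C }
    where
    none : ∀ c → let (o , s , s′) = c in s ∈ L → s′ ∈ L → Compatible o nothing nothing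
    none (eq  , _) _ _ = refl
    none (neq , _) _ _ _ ()
  coverable⇒partial (suc j) X∈ =
    let _ , e           = ∈-filter⁻ (extends? j L (coverable L j)) {xs = sublists L} X∈
        _ , X′∈ , elig  = find e
    in extend (coverable⇒partial j X′∈) elig

  solvable⇒assignment : (∀ t → Nonempty (lookup policy t)) → Solvable L → Assignment
  solvable⇒assignment nonempty sol
    with X , X∈ , L∖X≡[] ← find sol = record
    { user       = proj₁ ∘ pick
    ; authorized = λ {t} _ → proj₁ (proj₂ (pick t))
    ; satisfies  = All.map (λ {c} → satisfies′ c) satisfies
    }
    where
    open Partial (coverable⇒partial n X∈)

    pick : ∀ t → Σ[ u ∈ Fin n ] u ∈ₛ lookup policy t × (∀ {i} → user t ≡ just i → toℕ u ≡ i)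
    pick t with user t in u≡
    -- Every step of `L` has a user by now, so an unassigned step lies outside `L` and any
    -- authorized user will do.
    ... | nothing = let u , u∈ = nonempty t in u , u∈ , λ ()
    ... | just i  =
      let u , u≡i , u∈ = bitAt⁻ i (lookup policy t) (proj₂ (authorized u≡))
      in u , u∈ , λ i≡ → trans u≡i (just-injective i≡)

    covered : ∀ {t} → t ∈ L → user t ≡ just (toℕ (proj₁ (pick t)))
    covered {t} t∈L with t ∈? X
    ... | yes t∈X = let i , u≡ = covers t∈X in trans u≡ (cong just (sym (proj₂ (proj₂ (pick t)) u≡)))
    ... | no t∉X with () ← subst (t ∈_) L∖X≡[] (∈-∖⁺ t∈L t∉X)

    satisfies′ : ∀ c → let (o , s , s′) = c in
                 (s ∈ L → s′ ∈ L → Compatible o (user s) (user s′)) →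
                 s ∈ L → s′ ∈ L → ⟦ o ⟧ (proj₁ (pick s)) (proj₁ (pick s′))
    satisfies′ (eq  , s , s′) h s∈ s′∈ = Fin.toℕ-injective
      (just-injective (trans (sym (covered s∈)) (trans (h s∈ s′∈) (covered s′∈))))
    satisfies′ (neq , s , s′) h s∈ s′∈ u≡ =
      h s∈ s′∈ _ (covered s∈) (trans (covered s′∈) (cong (just ∘ toℕ) (sym u≡)))

-- Derived workflows and assignments

module _ (I : Instance) where
  open Instance I
  open Correctness policy constraints

  satisfiable⇒assignment : ∀ L → Satisfiable (derived workflow (toSubset L) ⊆⊤) → Assignment L
  satisfiable⇒assignment L (π , auth , sat) = record
    { user       = user
    ; authorized = λ {t} t∈L → let p = ∈-toSubset⁺ t∈L in
        subst (_∈ₛ lookup policy t) (sym (user≡ p)) (proj₂ (auth t p))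
    ; satisfies  = All.tabulate λ {c} → satisfied c
    }
    where
    user : Fin #S → Fin #U
    user t with t ∈ₛ? toSubset L
    ... | yes p = π t p
    ... | no  _ = proj₁ (nonempty t)

    user≡ : ∀ {t} (p : t ∈ₛ toSubset L) → user t ≡ π t p
    user≡ {t} p with t ∈ₛ? toSubset L
    -- A plan may depend on the proof of membership, and such proofs are unique.
    ... | yes q = cong (π t) ([]=-irrelevant q p)
    ... | no ¬p = ⊥-elim (¬p p)

    satisfied : ∀ c → let (o , s , s′) = c in
                c ∈ constraints → s ∈ L → s′ ∈ L → ⟦ o ⟧ (user s) (user s′)
    satisfied (o , s , s′) c∈ s∈ s′∈
      -- Both steps lie in `L`, so the constraint survives the restriction; its sides are
      -- singletons, which determines the witnesses `t` and `t′`.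
      with t , t′ , p , q , ρ ← All.lookup sat
             (∈-map⁺ (restrict (toSubset L))
               (∈-filter⁺ _ (∈-map⁺ constraint c∈)
                 ((s , x∈p∩q⁺ (x∈⁅x⁆ s , ∈-toSubset⁺ s∈)) , (s′ , x∈p∩q⁺ (x∈⁅x⁆ s′ , ∈-toSubset⁺ s′∈)))))
      with refl ← x∈⁅y⁆⇒x≡y s (proj₁ (x∈p∩q⁻ ⁅ s ⁆ (toSubset L) p))
         | refl ← x∈⁅y⁆⇒x≡y s′ (proj₁ (x∈p∩q⁻ ⁅ s′ ⁆ (toSubset L) q))
      = subst₂ ⟦ o ⟧ (sym (user≡ _)) (sym (user≡ _)) ρ

  assignment⇒satisfiable : ∀ L → Assignment L → Satisfiable (derived workflow (toSubset L) ⊆⊤)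
  assignment⇒satisfiable L σ =
    (λ s _ → user s) ,
    (λ s p → p , authorized (∈-toSubset⁻ L p)) ,
    All.map⁺ (All.tabulate λ c∈ → satisfied (∈-filter⁻ _ {xs = map constraint constraints} c∈))
    where
    open Assignment L σ

    satisfied : ∀ {c} → let open Constraint c in
                c ∈ map constraint constraints × Nonempty (T₁ ∩ toSubset L) × Nonempty (T₂ ∩ toSubset L) →
                Satisfies (λ s _ → user s) (restrict (toSubset L) c)
    satisfied (c∈ , (t , t∈) , (t′ , t′∈))
      with (o , s , s′) , c∈C , refl ← ∈-map⁻ constraint c∈
      with p , t∈L ← x∈p∩q⁻ ⁅ s ⁆ (toSubset L) t∈ | q , t′∈L ← x∈p∩q⁻ ⁅ s′ ⁆ (toSubset L) t′∈
      with refl ← x∈⁅y⁆⇒x≡y s p | refl ← x∈⁅y⁆⇒x≡y s′ q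
      = s , s′ , t∈ , t′∈ , All.lookup satisfies c∈C (∈-toSubset⁻ L t∈L) (∈-toSubset⁻ L t′∈L)

  solvable⇒satisfiable : ∀ {L} → Algorithm.Solvable policy constraints L →
                         Satisfiable (derived workflow (toSubset L) ⊆⊤)
  solvable⇒satisfiable {L} sol = assignment⇒satisfiable L (solvable⇒assignment L nonempty sol)

  satisfiable⇒solvable : ∀ {L} → Satisfiable (derived workflow (toSubset L) ⊆⊤) →
                         Algorithm.Solvable policy constraints L
  satisfiable⇒solvable {L} sat = assignment⇒solvable L (satisfiable⇒assignment L sat)

  weak⇔ : Any (Algorithm.Solvable policy constraints) (executions spec) ⇔ WeaklySatisfiable I
  weak⇔ = mk⇔ to from
    where
    to : Any (Algorithm.Solvable policy constraints) (executions spec) → WeaklySatisfiable I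
    to sol = let L , L∈ , s = find sol in
      toSubset L , subst (toSubset L ∈_) (sym (executionSets≡ spec)) (∈-map⁺ toSubset L∈) ,
      solvable⇒satisfiable s

    from : WeaklySatisfiable I → Any (Algorithm.Solvable policy constraints) (executions spec)
    from (S , S∈ , s) with L , L∈ , refl ← ∈-map⁻ toSubset (subst (S ∈_) (executionSets≡ spec) S∈) =
      lose L∈ (satisfiable⇒solvable s)

  strong⇔ : All (Algorithm.Solvable policy constraints) (executions spec) ⇔ StronglySatisfiable I
  strong⇔ = mk⇔ to from
    where
    to : All (Algorithm.Solvable policy constraints) (executions spec) → StronglySatisfiable I
    to sols S S∈ with L , L∈ , refl ← ∈-map⁻ toSubset (subst (S ∈_) (executionSets≡ spec) S∈) =
      solvable⇒satisfiable (All.lookup sols L∈)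

    from : StronglySatisfiable I → All (Algorithm.Solvable policy constraints) (executions spec)
    from sat = All.tabulate λ {L} L∈ → satisfiable⇒solvable
      (sat (toSubset L) (subst (toSubset L ∈_) (sym (executionSets≡ spec)) (∈-map⁺ toSubset L∈)))

-- The time bound

length≤size : ∀ {X : Set} (f : X → Tree) xs → length xs ≤ size (encodeList f xs)
length≤size f []       = z≤n
length≤size f (x ∷ xs) = s≤s (≤-trans (length≤size f xs) (m≤n+m _ (size (f x))))

lookup≤size : ∀ {X : Set} (f : X → Tree) (xs : Vec X m) i →
              size (f (lookup xs i)) ≤ size (encodeList f (toList xs))
lookup≤size f (x ∷ xs) zero    = ≤-trans (m≤m+n (size (f x)) _) (n≤1+n _)
lookup≤size f (x ∷ xs) (suc i) = ≤-trans (lookup≤size f xs i) (≤-trans (m≤n+m _ (size (f x))) (n≤1+n _))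

-- Yields a row of the policy; its length bounds the number of users by the size of the input.
first-step : Spec m → Fin m
first-step (step s)        = s
first-step (W ⨾ _ ⟨ _ ⟩) = first-step W
first-step (W ∥ _ ⟨ _ ⟩) = first-step W
first-step (W ⊕ _ ⟨ _ ⟩) = first-step W

2^b*2^b≡4^b : ∀ b → 2 ^ b * 2 ^ b ≡ 4 ^ b
2^b*2^b≡4^b b = begin
  2 ^ b * 2 ^ b   ≡⟨ ^-distribˡ-+-* 2 b b ⟨
  2 ^ (b + b)     ≡⟨ cong (λ c → 2 ^ (b + c)) (+-identityʳ b) ⟨
  2 ^ (2 * b)     ≡⟨ ^-*-assoc 2 2 b ⟨
  4 ^ b           ∎
  where open ≡-Reasoning

-- The constant 256 = 4^4 covers the cases b ≤ 4, where b − 1 < 4.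
4^b-bound : ∀ b → 2 ^ b * 2 ^ b ≤ 256 * ((b ∸ 1) ^ b ⊔ 1)
4^b-bound b with b ≤? 4
... | yes b≤4 = begin
  2 ^ b * 2 ^ b                 ≡⟨ 2^b*2^b≡4^b b ⟩
  4 ^ b                         ≤⟨ ^-monoʳ-≤ 4 b≤4 ⟩
  256 * 1                       ≤⟨ *-monoʳ-≤ 256 (m≤n⊔m ((b ∸ 1) ^ b) 1) ⟩
  256 * ((b ∸ 1) ^ b ⊔ 1)       ∎
  where open ≤-Reasoning
... | no b≰4 = begin
  2 ^ b * 2 ^ b                 ≡⟨ 2^b*2^b≡4^b b ⟩
  4 ^ b                         ≤⟨ ^-monoˡ-≤ b (∸-monoˡ-≤ 1 (≰⇒> b≰4)) ⟩
  (b ∸ 1) ^ b                   ≤⟨ m≤m⊔n ((b ∸ 1) ^ b) 1 ⟩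
  (b ∸ 1) ^ b ⊔ 1               ≤⟨ m≤n*m ((b ∸ 1) ^ b ⊔ 1) 256 ⟩
  256 * ((b ∸ 1) ^ b ⊔ 1)       ∎
  where open ≤-Reasoning

-- Each of the successors of `l`, `2 ^ b` and `2 ^ b` costs a factor 2, and 2048 is this 8 times the
-- 256 of `4^b-bound`. The exponent 5 counts the entries `N`.
budget-bound : ∀ N l b → 1 ≤ l →
  ⟦ N ∷ l ∷ N ∷ 2 ^ b ∷ 2 ^ b ∷ N ∷ N ∷ N ∷ [] ⟧ᵤ ≤ 2048 * suc N ^ 5 * (l * ((b ∸ 1) ^ b ⊔ 1))
budget-bound N l b 1≤l = begin
  S * (suc l * (S * (suc K * (suc K * W))))
    ≤⟨ *-monoʳ-≤ S (*-mono-≤ (suc≤2* 1≤l) (*-monoʳ-≤ S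
         (*-mono-≤ K≤ (*-monoˡ-≤ W K≤)))) ⟩
  S * (2 * l * (S * (2 * K * (2 * K * W))))
    ≡⟨ solve 4 (λ c s l k → let w = s :* (s :* (s :* con 1)) in
           s :* (c :* l :* (s :* (c :* k :* (c :* k :* w)))) :=
           c :* c :* c :* s :^ 5 :* (l :* (k :* k))) refl 2 S l K ⟩
  8 * S ^ 5 * (l * (K * K))
    ≤⟨ *-monoʳ-≤ (8 * S ^ 5) (*-monoʳ-≤ l (4^b-bound b)) ⟩
  8 * S ^ 5 * (l * (256 * B))
    ≡⟨ solve 5 (λ c d p l b → c :* p :* (l :* (d :* b)) := c :* d :* p :* (l :* b)) refl 8 256 (S ^ 5) l B ⟩
  2048 * S ^ 5 * (l * B) ∎
  where
  open ≤-Reasoning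
  open +-*-Solver
  S = suc N
  K = 2 ^ b
  W = ⟦ N ∷ N ∷ N ∷ [] ⟧ᵤ
  B = (b ∸ 1) ^ b ⊔ 1
  K≤ : suc K ≤ 2 * K
  K≤ = suc≤2* (^-monoʳ-≤ 2 {0} {b} z≤n)

-- Abstract because the type checker would unfold products with so large a
-- literal.
abstract
  factor : ℕ
  factor = 3000 * 2048

  time-bound : ∀ N l b {t} → 1 ≤ l →
    t ≤ 3000 * ⟦ N ∷ l ∷ N ∷ 2 ^ b ∷ 2 ^ b ∷ N ∷ N ∷ N ∷ [] ⟧ᵤ →
    t ≤ factor * suc N ^ 5 * (l * ((b ∸ 1) ^ b ⊔ 1))
  time-bound N l b 1≤l t≤ = compose 3000 2048 (suc N ^ 5) _ t≤ (budget-bound N l b 1≤l)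
    where
    compose : ∀ c d p q {t u} → t ≤ c * u → u ≤ d * p * q → t ≤ c * d * p * q
    compose c d p q t≤ u≤ = ≤-trans t≤ (≤-trans (*-monoʳ-≤ c u≤) (≤-reflexive
      (trans (sym (*-assoc c (d * p) q)) (cong (_* q) (sym (*-assoc c d p))))))

-- The two programs and their total time

program : Fin 21 → Program
program f = record
  { arity  = 21
  ; bodies = bodies
  ; main   = case (ν 0) nil (call f (ν 1 ∙ call `executions (ν 0)))
  }

module _ (I : Instance) where
  open Instance I

  private
    policyᵉ constraintsᵉ : Tree
    policyᵉ      = encodeList encodeSubset (toList policy)
    constraintsᵉ = encodeList encodeConstraint constraints

    -- One less than the size of the encoded instance, so that `suc N` is `size (encode I)` by
    -- computation.
    N : ℕ
    N = size (encodeSpec spec) + suc (size policyᵉ + size constraintsᵉ)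

    policy≤N : size policyᵉ ≤ N
    policy≤N = ≤-trans (m≤m+n _ (size constraintsᵉ)) (≤-trans (n≤1+n _) (m≤n+m _ (size (encodeSpec spec))))

    m≤N : #S ≤ N
    m≤N = ≤-trans (≤-reflexive (sym (length-toList policy)))
            (≤-trans (length≤size encodeSubset (toList policy)) policy≤N)

    n≤N : #U ≤ N
    n≤N = ≤-trans (≤-reflexive (sym (length-toList row)))
            (≤-trans (length≤size encodeBool (toList row))
              (≤-trans (lookup≤size encodeSubset policy (first-step spec)) policy≤N))
      where row = lookup policy (first-step spec)

    C≤N : length constraints ≤ N
    C≤N = ≤-trans (length≤size encodeConstraint constraints)
            (≤-trans (m≤n+m _ (size policyᵉ)) (≤-trans (n≤1+n _) (m≤n+m _ (size (encodeSpec spec)))))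

  open Algorithm policy constraints public using () renaming (solvable? to solvableᴵ?)
  open Running policy constraints N m≤N n≤N C≤N

  private
    l : ℕ
    l = length (executions spec)

    V : Unit
    -- The leading `N` absorbs the size of the specification in the cost of the enumeration; the
    -- remaining factors are the loop over the execution sets and the budget of `solve`.
    V = N ∷ l ∷ budget (first-step spec) (♭ spec)

    executions-bounded : All (Bounded (first-step spec) (♭ spec)) (executions spec)
    executions-bounded = All.tabulate λ X∈ →
      ≤-trans (execution-length≤m spec X∈) m≤N , execution-length≤♭ spec X∈

    program-time : ∀ f y →
      Fun f ((policyᵉ ∙ constraintsᵉ) ∙ encodeFamily (executions spec)) y 2100
        (l ∷ budget (first-step spec) (♭ spec)) →
      ∃[ t ] Runs (program f) (encode I) y t ×
             t ≤ factor * size (encode I) ^ 5 * bound I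
    program-time f y r = Run.time total , Run.derivation total ,
      subst (λ k → Run.time total ≤ factor * size (encode I) ^ 5 * (k * ((♭ spec ∸ 1) ^ ♭ spec ⊔ 1)))
        (sym (♯≡length spec))
        (time-bound N l (♭ spec) (executions-nonempty spec) (Run.time≤ total))
      where
      executions-time : Fun `executions (encodeSpec spec) (encodeFamily (executions spec)) 600 V
      executions-time = scale (≤-refl ∷ ≤-refl ∷ ≤-refl ∷ [])
        (absorb {i = size (encodeSpec spec)} 600 (m≤n⇒m≤1+n (m≤m+n (size (encodeSpec spec)) _)) (executionsʳ N m≤N spec))

      total : Run bodies (encode I ∷ []) (Program.main (program f)) y 3000 V
      total = upTo 3000 (case-∙ʳ varʳ
        (callʳ (varʳ ∙ʳ callʳ varʳ executions-time) (scale (skip ⊑-refl) r)))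

  decides-weak : ∃[ t ] Runs (program `anySolvable) (encode I)
                          (encodeBool (does (any? solvableᴵ? (executions spec)))) t ×
                        t ≤ factor * size (encode I) ^ 5 * bound I
  decides-weak = program-time `anySolvable _
    (anySolvableʳ (first-step spec) (♭ spec) (executions spec) executions-bounded)

  decides-strong : ∃[ t ] Runs (program `allSolvable) (encode I)
                            (encodeBool (does (all? solvableᴵ? (executions spec)))) t ×
                          t ≤ factor * size (encode I) ^ 5 * bound I
  decides-strong = program-time `allSolvable _
    (allSolvableʳ (first-step spec) (♭ spec) (executions spec) executions-bounded)

proposition8 : DecidableInTimeO WeaklySatisfiable bound × DecidableInTimeO StronglySatisfiable bound
proposition8 =
  (program `anySolvable , factor , 5 , λ I →
    let t , runs , t≤ = decides-weak I
    in _ , t , runs , proof (Dec.map (weak⇔ I) (any? (solvableᴵ? I) (executions (Instance.spec I)))) , t≤) ,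
  (program `allSolvable , factor , 5 , λ I →
    let t , runs , t≤ = decides-strong I
    in _ , t , runs , proof (Dec.map (strong⇔ I) (all? (solvableᴵ? I) (executions (Instance.spec I)))) , t≤)
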